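{- For every integer $m\ge 1$ and every integer $n\ge1$, \[ a^+_m(n)=(-1)^{m-1}\sum_{l=0}^{m-1}(-1)^{l} \left( p\!\left(n-\tfrac{3l^2+l}{2}\right)-p\!\left(n-\tfrac{3(l+1)^2-(l+1)}{2}\right) \right) \] and \[ a^-_m(n)= (-1)^{m-1}\sum_{l=0}^{m-1}(-1)^l \left( p\!\left(n-\tfrac{3l^2-l}{2}\right)-p\!\left(n-\tfrac{3(l+1)^2+(l+1)}{2}\right) \right). \]
   Context: $p(n)$ is the number of partitions of $n$, with $p(0)=1$ and $p(k)=0$ for $k<0$. Every partition of $n$ has a Frobenius symbol $\begin{pmatrix} x_1 & \cdots & x_d\\ y_1&\cdots & y_d\end{pmatrix}$, where $d$ is the number of dots on the main diagonal of the Ferrers graph, $x_i$ (resp. $y_i$) is the number of dots in row $i$ to the right of the diagonal (resp. in column $i$ below the diagonal). Column $i$ is positive if $x_i-y_i\ge 1$ and negative if $x_i-y_i\le 0$. Parity blocks are maximal sets of contiguous columns all of the same sign; a block is positive/negative according to the sign of its columns. $a^+_m(n)$ (resp. $a^-_m(n)$) is the number of partitions of $n$ whose Frobenius symbol has exactly $m$ parity blocks, the last (rightmost) one positive (resp. negative). -}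

module Defs where

open import Data.Nat as ℕ using (ℕ; zero; suc; _∸_; _<?_; _≤?_)
open import Data.Nat.DivMod using (_/_)
open import Data.Integer as ℤ using (ℤ; +_; -[1+_])
open import Data.List using (List; []; _∷_; [_]; map; concatMap; filter; length; upTo; sum; foldr; applyUpTo)
open import Data.Bool using (Bool; true; false; if_then_else_; _∧_)
import Data.Bool
open import Relation.Nullary.Decidable using (⌊_⌋)

-- A partition of n is represented as a weakly decreasing list of positive
-- parts (λ₁ ≥ λ₂ ≥ … > 0) summing to n.
-- partsLE f k n : all partitions of n with every part ≤ k (fuel f ≥ n).
partsLE : ℕ → ℕ → ℕ → List (List ℕ)
partsLE _       _ zero    = [ [] ]
partsLE zero    _ (suc _) = []
partsLE (suc f) k (suc n) =
  concatMap (λ j → map (j ∷_) (partsLE f j (suc n ∸ j)))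
            (filter (λ j → j ℕ.≤? suc n) (applyUpTo suc k))

partitions : ℕ → List (List ℕ)
partitions n = partsLE n n n

p : ℕ → ℕ
p n = length (partitions n)

pℤ : ℤ → ℤ
pℤ (+ n)    = + p n
pℤ -[1+ _ ] = + 0

-- i-th part (1-indexed), 0 beyond the length
part : List ℕ → ℕ → ℕ
part []       _       = 0
part (x ∷ _)  1       = x
part (_ ∷ xs) (suc (suc i)) = part xs (suc i)
part (_ ∷ _)  zero    = 0

conj : List ℕ → ℕ → ℕ
conj λs i = length (filter (λ x → i ℕ.≤? x) λs)

durfee : List ℕ → ℕ
durfee λs = length (filter (λ i → i ℕ.≤? part λs i) (applyUpTo suc (length λs)))

frobX frobY : List ℕ → List ℕ
frobX λs = map (λ i → part λs i ∸ i) (applyUpTo suc (durfee λs))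
frobY λs = map (λ i → conj λs i ∸ i) (applyUpTo suc (durfee λs))

-- column sign: true = positive (x_i - y_i ≥ 1), false = negative (x_i - y_i ≤ 0)
colSigns : List ℕ → List Bool
colSigns λs = zipSigns (frobX λs) (frobY λs)
  where
  zipSigns : List ℕ → List ℕ → List Bool
  zipSigns (x ∷ xs) (y ∷ ys) = ⌊ y ℕ.<? x ⌋ ∷ zipSigns xs ys
  zipSigns _ _ = []

_==_ : Bool → Bool → Bool
true  == b = b
false == true  = false
false == false = true

-- number of maximal runs of equal consecutive entries (parity blocks)
runs : List Bool → ℕ
runs []           = 0
runs (b ∷ [])     = 1
runs (b ∷ c ∷ bs) = (if b == c then 0 else 1) ℕ.+ runs (c ∷ bs)

lastSign : List Bool → Bool → Bool
lastSign []       d = d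
lastSign (b ∷ bs) _ = lastSign bs b

hasBlocks : ℕ → Bool → List ℕ → Bool
hasBlocks m s λs with colSigns λs
... | []       = false
... | (b ∷ bs) = ⌊ runs (b ∷ bs) ℕ.≟ m ⌋ ∧ (lastSign bs b == s)

aPlus aMinus : ℕ → ℕ → ℕ
aPlus  m n = length (filter (λ λs → hasBlocks m true  λs Data.Bool.≟ true) (partitions n))
aMinus m n = length (filter (λ λs → hasBlocks m false λs Data.Bool.≟ true) (partitions n))

sgn : ℕ → ℤ
sgn zero          = + 1
sgn (suc zero)    = ℤ.- (+ 1)
sgn (suc (suc k)) = sgn k

sumTo : ℕ → (ℕ → ℤ) → ℤ
sumTo zero    f = + 0
sumTo (suc m) f = sumTo m f ℤ.+ f m

-- (3l²+l)/2 and (3l²-l)/2 (both exact naturals)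
penPlus penMinus : ℕ → ℕ
penPlus  l = (3 ℕ.* l ℕ.* l ℕ.+ l) / 2
penMinus l = (3 ℕ.* l ℕ.* l ∸ l) / 2

{-# OPTIONS --safe #-}
module Submission where

-- A partition has an alternating sequence of m column signs, with prescribed
-- first sign, as a subsequence iff it has at least m blocks, or m + 1 if its
-- first sign is the other one.  Let A(m) count the partitions of n with such a
-- sequence ending in the sign s (the first sign depends on m).  Then
-- a^s_m + a^s_{m+1} is A(m) minus the count for the same first sign and length
-- m + 1, and the theorem follows from A(m) = p(n − (3m² ± m)/2) by telescoping.
--
-- A(m) is found by reflection.  Reading the entries of the Frobenius symbol
-- from the largest down, #X − #Y is a lattice path from 0 to 0, and a positive
-- (negative) column is a visit to 1 (to −1), so A(m) counts the paths that
-- visit 1 and −1 alternately m times.  Reflecting the rest of the path after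
-- each visit turns these into all paths with another end point.  Paths with a
-- given end point are counted by a Gaussian binomial [t, i], so the reflection
-- is the symmetry [t, i] = [t, t − i], and for large t the coefficients of the
-- Gaussian binomial are partition numbers.

open import Defs
open import Data.Nat using (ℕ; suc; _≥_)
open import Data.Integer using (ℤ; +_; _+_; _-_; _*_)
open import Data.Product using (_×_)
open import Relation.Binary.PropositionalEquality using (_≡_)

open import Data.Bool using (Bool; true; false; if_then_else_; not; _∧_)
open import Data.Bool.Properties using (not-involutive)
open import Data.Integer using (-[1+_]; -_; 0ℤ; 1ℤ)
import Data.Integer.Properties as ℤₚ
import Data.Integer.Tactic.RingSolver as ℤ-Ring
open import Data.List using (List; []; _∷_; [_]; _++_; length; map; replicate; filter; applyUpTo; concatMap)
open import Data.List.Membership.Propositional using (_∈_)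
open import Data.List.Membership.Propositional.Properties using (∈-map⁻; ∈-map⁺; ∈-++⁺ˡ; ∈-++⁺ʳ; ∈-∃++; ∈-++⁻)
import Data.List.Properties as Listₚ
open import Data.List.Relation.Binary.Permutation.Propositional using (_↭_; prep; swap; ↭-refl; ↭-sym; ↭-trans)
import Data.List.Relation.Binary.Permutation.Propositional.Properties as ↭ₚ
open import Data.List.Relation.Unary.All as All using (All; []; _∷_)
import Data.List.Relation.Unary.All.Properties as Allₚ
open import Data.List.Relation.Unary.AllPairs using ([]; _∷_)
open import Data.List.Relation.Unary.Any using (here; there)
open import Data.List.Relation.Unary.Unique.Propositional using (Unique)
import Data.List.Relation.Unary.Unique.Propositional.Properties as Uniqueₚ
import Data.Nat as ℕ
open import Data.Nat.DivMod using (_/_; m*n/n≡m)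
open import Data.Nat.ListAction using (sum)
import Data.Nat.Properties as ℕₚ
import Data.Nat.Tactic.RingSolver as ℕ-Ring
open import Data.Product using (_,_; map₁; map₂; proj₁; proj₂)
open import Data.Sum using (inj₁; inj₂)
open import Function using (_∘_)
open import Relation.Binary.PropositionalEquality
  using (refl; sym; trans; cong; cong₂; subst; subst₂; _≢_; module ≡-Reasoning)
open import Relation.Nullary using (yes; no; ¬_; contradiction)
open import Relation.Nullary.Decidable using (⌊_⌋; isYes≗does)
open import Relation.Unary using (Decidable)

-- Gaussian binomials

-- The coefficients of the constant polynomial 1. Integer indices let the recursion of `g` leave the
-- range 0 ≤ i ≤ t or reach negative weights, where it yields 0 without side conditions.
unit : ℤ → ℕ
unit (+ 0) = 1
unit _     = 0

-- g t i w is the number of partitions of w into at most i parts, each at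
-- most t − i, that is, the coefficient of q^w in the Gaussian binomial [t, i].
g : ℕ → ℤ → ℤ → ℕ
g 0       i w = unit i ℕ.* unit w
g (suc t) i w = g t i w ℕ.+ g t (i - 1ℤ) (w - (+ suc t - i))

-- The other q-Pascal rule.
g-suc : ∀ t i w → g (suc t) i w ≡ g t (i - 1ℤ) w ℕ.+ g t i (w - i)
g-suc 0 (+ 0) w = trans (ℕₚ.+-identityʳ _) (cong (λ v → unit v ℕ.+ 0) (sym (ℤₚ.+-identityʳ w)))
g-suc 0 (+ 1) w = trans (cong (λ v → unit v ℕ.+ 0) (ℤₚ.+-identityʳ w)) (sym (ℕₚ.+-identityʳ _))
g-suc 0 (+ suc (suc n)) w = refl
g-suc 0 -[1+ n ] w = refl
-- The induction hypothesis is applied to both terms of the defining rule; exchanging the middle two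
-- of the four terms gives the defining rule of each term on the right.
g-suc (suc t) i w = begin
  g (suc t) i w ℕ.+ g (suc t) (i - 1ℤ) (w - (+ suc (suc t) - i))
    ≡⟨ cong₂ ℕ._+_ (g-suc t i w) (g-suc t (i - 1ℤ) (w - (+ suc (suc t) - i))) ⟩
  (g t (i - 1ℤ) w ℕ.+ g t i (w - i)) ℕ.+
  (g t (i - 1ℤ - 1ℤ) (w - (+ suc (suc t) - i)) ℕ.+ g t (i - 1ℤ) (w - (+ suc (suc t) - i) - (i - 1ℤ)))
    ≡⟨ cong₂ (λ u v → (g t (i - 1ℤ) w ℕ.+ g t i (w - i)) ℕ.+ (g t (i - 1ℤ - 1ℤ) u ℕ.+ g t (i - 1ℤ) v))
         (e₁ (+ t) i w) (e₂ (+ t) i w) ⟩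
  (g t (i - 1ℤ) w ℕ.+ g t i (w - i)) ℕ.+
  (g t (i - 1ℤ - 1ℤ) (w - (+ suc t - (i - 1ℤ))) ℕ.+ g t (i - 1ℤ) (w - i - (+ suc t - i)))
    ≡⟨ +-interchange (g t (i - 1ℤ) w) _ _ _ ⟩
  g (suc t) (i - 1ℤ) w ℕ.+ g (suc t) i (w - i) ∎
  where
  open ≡-Reasoning
  +-interchange : ∀ a b c d → (a ℕ.+ b) ℕ.+ (c ℕ.+ d) ≡ (a ℕ.+ c) ℕ.+ (b ℕ.+ d)
  +-interchange = ℕ-Ring.solve-∀
  e₁ : ∀ t i w → w - (1ℤ + (1ℤ + t) - i) ≡ w - (1ℤ + t - (i - 1ℤ))
  e₁ = ℤ-Ring.solve-∀
  e₂ : ∀ t i w → w - (1ℤ + (1ℤ + t) - i) - (i - 1ℤ) ≡ w - i - (1ℤ + t - i)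
  e₂ = ℤ-Ring.solve-∀

-- Conjugation of partitions in an i by t - i box. In the induction, i ↦ t - i exchanges the
-- defining Pascal rule with `g-suc`.
g-sym : ∀ t i w → g t i w ≡ g t (+ t - i) w
g-sym 0 (+ 0) w = refl
g-sym 0 (+ suc n) w = refl
g-sym 0 -[1+ n ] w = refl
g-sym (suc t) i w = begin
  g t i w ℕ.+ g t (i - 1ℤ) (w - (+ suc t - i))
    ≡⟨ ℕₚ.+-comm (g t i w) _ ⟩
  g t (i - 1ℤ) (w - (+ suc t - i)) ℕ.+ g t i w
    ≡⟨ cong₂ ℕ._+_ (g-sym t (i - 1ℤ) _) (g-sym t i w) ⟩
  g t (+ t - (i - 1ℤ)) (w - (+ suc t - i)) ℕ.+ g t (+ t - i) w
    ≡⟨ cong₂ (λ u v → g t u (w - (+ suc t - i)) ℕ.+ g t v w) (e₁ (+ t) i) (e₂ (+ t) i) ⟩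
  g t (+ suc t - i) (w - (+ suc t - i)) ℕ.+ g t (+ suc t - i - 1ℤ) w
    ≡⟨ ℕₚ.+-comm (g t (+ suc t - i) (w - (+ suc t - i))) _ ⟩
  g t (+ suc t - i - 1ℤ) w ℕ.+ g t (+ suc t - i) (w - (+ suc t - i))
    ≡⟨ g-suc t (+ suc t - i) w ⟨
  g (suc t) (+ suc t - i) w ∎
  where
  open ≡-Reasoning
  e₁ : ∀ t i → t - (i - 1ℤ) ≡ 1ℤ + t - i
  e₁ = ℤ-Ring.solve-∀
  e₂ : ∀ t i → t - i ≡ 1ℤ + t - i - 1ℤ
  e₂ = ℤ-Ring.solve-∀

-- Triangular numbers at integer arguments

tri : ℕ → ℕ
tri 0       = 0
tri (suc n) = n ℕ.+ tri n

-- T c = c (c − 1) / 2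
T : ℤ → ℤ
T (+ n)    = + tri n
T -[1+ n ] = + tri (suc (suc n))

T-suc : ∀ c → T (c + 1ℤ) ≡ T c + c
T-suc (+ n) = begin
  + tri (n ℕ.+ 1)   ≡⟨ cong (λ k → + tri k) (ℕₚ.+-comm n 1) ⟩
  + (n ℕ.+ tri n)   ≡⟨ cong +_ (ℕₚ.+-comm n (tri n)) ⟩
  + (tri n ℕ.+ n)   ∎
  where open ≡-Reasoning
T-suc -[1+ 0 ] = refl
T-suc -[1+ suc n ] = e (+ n) (+ tri (suc (suc n)))
  where
  e : ∀ n t → t ≡ 1ℤ + 1ℤ + n + t + - (1ℤ + 1ℤ + n)
  e = ℤ-Ring.solve-∀

T-pred : ∀ c → T (c - 1ℤ) ≡ T c - (c - 1ℤ)
T-pred c = trans (e₁ (T (c - 1ℤ)) (c - 1ℤ)) (cong (_- (c - 1ℤ)) (trans (sym (T-suc (c - 1ℤ))) (cong T (e₂ c))))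
  where
  e₁ : ∀ t c → t ≡ t + c - c
  e₁ = ℤ-Ring.solve-∀
  e₂ : ∀ c → c - 1ℤ + 1ℤ ≡ c
  e₂ = ℤ-Ring.solve-∀

T-neg : ∀ c → T (- c) ≡ T c + c
T-neg (+ 0) = refl
T-neg (+ suc n) = cong +_ (ℕₚ.+-comm (suc n) (tri (suc n)))
T-neg -[1+ n ] = e (+ n) (+ tri (suc n))
  where
  e : ∀ n t → t ≡ 1ℤ + n + t + - (1ℤ + n)
  e = ℤ-Ring.solve-∀

T-refl : ∀ c → T (1ℤ - c) ≡ T c
T-refl c = begin
  T (1ℤ - c)       ≡⟨ cong T (ℤₚ.+-comm 1ℤ (- c)) ⟩
  T (- c + 1ℤ)     ≡⟨ T-suc (- c) ⟩
  T (- c) + - c    ≡⟨ cong (_- c) (T-neg c) ⟩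
  T c + c - c      ≡⟨ e (T c) c ⟩
  T c ∎
  where
  open ≡-Reasoning
  e : ∀ t c → t + c - c ≡ t
  e = ℤ-Ring.solve-∀

-- Generalised Frobenius symbols

Strip : Set
Strip = List ℕ × List ℕ

dbl : ℕ → ℕ
dbl 0       = 0
dbl (suc h) = suc (suc (dbl h))

dbl-+ : ∀ h → + dbl h ≡ + h + + h
dbl-+ 0       = refl
dbl-+ (suc h) = trans (cong (λ u → 1ℤ + (1ℤ + u)) (dbl-+ h)) (e (+ h))
  where
  e : ∀ h → 1ℤ + (1ℤ + (h + h)) ≡ 1ℤ + h + (1ℤ + h)
  e = ℤ-Ring.solve-∀

-- Pairs (X , Y) of strictly decreasing lists with |X| − |Y| = c and
-- ΣX + ΣY + |Y| = w.  Entries are below h, except that in Od the list X may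
-- also contain h.
Ev Od : ℕ → ℤ → ℤ → List Strip
Ev 0       c w = replicate (unit c ℕ.* unit w) ([] , [])
Ev (suc h) c w = Od h c w ++ map (map₂ (h ∷_)) (Od h (c + 1ℤ) (w - + suc h))
Od h       c w = Ev h c w ++ map (map₁ (h ∷_)) (Ev h (c - 1ℤ) (w - + h))

-- Each of the `dbl h` possible entries is a step of a lattice path; the X-entries present and the
-- Y-entries absent together are h + c steps of one kind, and `T c` is the least weight of charge c.
-- Deciding the top Y-entry is `g-suc`, deciding the top X-entry is the defining rule of `g`.
length-Ev : ∀ h c w → length (Ev h c w) ≡ g (dbl h) (+ h + c) (w - T c)
length-Od : ∀ h c w → length (Od h c w) ≡ g (suc (dbl h)) (+ h + c) (w - T c)

length-Ev 0 c w = trans (Listₚ.length-replicate (unit c ℕ.* unit w)) (e c)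
  where
  e : ∀ c → unit c ℕ.* unit w ≡ unit (+ 0 + c) ℕ.* unit (w - T c)
  e (+ 0)     = cong (λ v → 1 ℕ.* unit v) (sym (ℤₚ.+-identityʳ w))
  e (+ suc n) = refl
  e -[1+ n ]  = refl
length-Ev (suc h) c w = begin
  length (Od h c w ++ map (map₂ (h ∷_)) (Od h (c + 1ℤ) (w - + suc h)))
    ≡⟨ Listₚ.length-++ (Od h c w) ⟩
  length (Od h c w) ℕ.+ length (map (map₂ (h ∷_)) (Od h (c + 1ℤ) (w - + suc h)))
    ≡⟨ cong (length (Od h c w) ℕ.+_) (Listₚ.length-map _ (Od h (c + 1ℤ) _)) ⟩
  length (Od h c w) ℕ.+ length (Od h (c + 1ℤ) (w - + suc h))
    ≡⟨ cong₂ ℕ._+_ (length-Od h c w) (length-Od h (c + 1ℤ) _) ⟩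
  g t (+ h + c) (w - T c) ℕ.+ g t (+ h + (c + 1ℤ)) (w - + suc h - T (c + 1ℤ))
    ≡⟨ cong (λ u → g t (+ h + c) (w - T c) ℕ.+ g t (+ h + (c + 1ℤ)) (w - + suc h - u)) (T-suc c) ⟩
  g t (+ h + c) (w - T c) ℕ.+ g t (+ h + (c + 1ℤ)) (w - + suc h - (T c + c))
    ≡⟨ cong₂ ℕ._+_ (cong (λ i → g t i (w - T c)) (e₁ (+ h) c)) (cong₂ (g t) (e₂ (+ h) c) (e₃ (+ h) c w (T c))) ⟩
  g t (+ suc h + c - 1ℤ) (w - T c) ℕ.+ g t (+ suc h + c) (w - T c - (+ suc h + c))
    ≡⟨ g-suc t (+ suc h + c) (w - T c) ⟨
  g (suc t) (+ suc h + c) (w - T c) ∎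
  where
  open ≡-Reasoning
  t = suc (dbl h)
  e₁ : ∀ h c → h + c ≡ 1ℤ + h + c - 1ℤ
  e₁ = ℤ-Ring.solve-∀
  e₂ : ∀ h c → h + (c + 1ℤ) ≡ 1ℤ + h + c
  e₂ = ℤ-Ring.solve-∀
  e₃ : ∀ h c w t → w - (1ℤ + h) - (t + c) ≡ w - t - (1ℤ + h + c)
  e₃ = ℤ-Ring.solve-∀

length-Od h c w = begin
  length (Ev h c w ++ map (map₁ (h ∷_)) (Ev h (c - 1ℤ) (w - + h)))
    ≡⟨ Listₚ.length-++ (Ev h c w) ⟩
  length (Ev h c w) ℕ.+ length (map (map₁ (h ∷_)) (Ev h (c - 1ℤ) (w - + h)))
    ≡⟨ cong (length (Ev h c w) ℕ.+_) (Listₚ.length-map _ (Ev h (c - 1ℤ) _)) ⟩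
  length (Ev h c w) ℕ.+ length (Ev h (c - 1ℤ) (w - + h))
    ≡⟨ cong₂ ℕ._+_ (length-Ev h c w) (length-Ev h (c - 1ℤ) _) ⟩
  g t (+ h + c) (w - T c) ℕ.+ g t (+ h + (c - 1ℤ)) (w - + h - T (c - 1ℤ))
    ≡⟨ cong (λ u → g t (+ h + c) (w - T c) ℕ.+ g t (+ h + (c - 1ℤ)) (w - + h - u)) (T-pred c) ⟩
  g t (+ h + c) (w - T c) ℕ.+ g t (+ h + (c - 1ℤ)) (w - + h - (T c - (c - 1ℤ)))
    ≡⟨ cong (g t (+ h + c) (w - T c) ℕ.+_) (cong₂ (g t) (e₁ (+ h) c) (trans (e₂ (+ h) c w (T c))
         (cong (λ d → w - T c - (1ℤ + d - (+ h + c))) (sym (dbl-+ h))))) ⟩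
  g (suc t) (+ h + c) (w - T c) ∎
  where
  open ≡-Reasoning
  t = dbl h
  e₁ : ∀ h c → h + (c - 1ℤ) ≡ h + c - 1ℤ
  e₁ = ℤ-Ring.solve-∀
  e₂ : ∀ h c w t → w - h - (t - (c - 1ℤ)) ≡ w - t - (1ℤ + (h + h) - (h + c))
  e₂ = ℤ-Ring.solve-∀

-- Exchanging X and Y replaces |Y| by |X| in the weight, hence the shift by c. On the level of
-- counts this is `g-sym`.
Ev-refl : ∀ h c w → length (Ev h c w) ≡ length (Ev h (- c) (w + c))
Ev-refl h c w = begin
  length (Ev h c w)                            ≡⟨ length-Ev h c w ⟩
  g (dbl h) (+ h + c) (w - T c)                ≡⟨ g-sym (dbl h) _ _ ⟩
  g (dbl h) (+ dbl h - (+ h + c)) (w - T c)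
    ≡⟨ cong₂ (g (dbl h)) (trans (cong (_- (+ h + c)) (dbl-+ h)) (e₁ (+ h) c)) (e₂ c w (T c)) ⟩
  g (dbl h) (+ h - c) (w + c - (T c + c))      ≡⟨ cong (λ u → g (dbl h) (+ h - c) (w + c - u)) (T-neg c) ⟨
  g (dbl h) (+ h - c) (w + c - T (- c))        ≡⟨ length-Ev h (- c) (w + c) ⟨
  length (Ev h (- c) (w + c))                  ∎
  where
  open ≡-Reasoning
  e₁ : ∀ h c → h + h - (h + c) ≡ h - c
  e₁ = ℤ-Ring.solve-∀
  e₂ : ∀ c w t → w - t ≡ w + c - (t + c)
  e₂ = ℤ-Ring.solve-∀

-- The underlying bijection exchanges the nonzero entries of X with the entries of Y raised by 1,
-- and toggles whether 0 lies in X. The weight is kept, since ΣY + |Y| is the sum of the raised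
-- entries.
Od-refl : ∀ h c w → length (Od h c w) ≡ length (Od h (1ℤ - c) w)
Od-refl h c w = begin
  length (Od h c w)                                    ≡⟨ length-Od h c w ⟩
  g (suc (dbl h)) (+ h + c) (w - T c)                  ≡⟨ g-sym (suc (dbl h)) _ _ ⟩
  g (suc (dbl h)) (+ suc (dbl h) - (+ h + c)) (w - T c)
    ≡⟨ cong₂ (g (suc (dbl h))) (trans (cong (λ u → 1ℤ + u - (+ h + c)) (dbl-+ h)) (e₁ (+ h) c)) (cong (λ u → w - u) (sym (T-refl c))) ⟩
  g (suc (dbl h)) (+ h + (1ℤ - c)) (w - T (1ℤ - c))    ≡⟨ length-Od h (1ℤ - c) w ⟨
  length (Od h (1ℤ - c) w)                             ∎
  where
  open ≡-Reasoning
  e₁ : ∀ h c → 1ℤ + (h + h) - (h + c) ≡ h + (1ℤ - c)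
  e₁ = ℤ-Ring.solve-∀

-- What a hit uses about the entries still to be read: the bounds fix the sign of the new column,
-- and the charge ensures that its second entry exists.
record WF (k h : ℕ) (c : ℤ) (s : Strip) : Set where
  constructor wf
  field
    boundX : All (ℕ._< k) (proj₁ s)
    boundY : All (ℕ._< h) (proj₂ s)
    charge : + length (proj₁ s) - + length (proj₂ s) ≡ c

Ev-WF : ∀ h c w → All (WF h h c) (Ev h c w)
Od-WF : ∀ h c w → All (WF (suc h) h c) (Od h c w)
Ev-WF 0 (+ 0) w = Allₚ.replicate⁺ (unit (+ 0) ℕ.* unit w) (wf [] [] refl)
Ev-WF 0 (+ suc n) w = []
Ev-WF 0 -[1+ n ] w = []
Ev-WF (suc h) c w = Allₚ.++⁺ (All.map widen (Od-WF h c w)) (Allₚ.map⁺ (All.map push (Od-WF h (c + 1ℤ) _)))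
  where
  widen : ∀ {s} → WF (suc h) h c s → WF (suc h) (suc h) c s
  widen (wf X Y e) = wf X (All.map ℕₚ.m<n⇒m<1+n Y) e
  e₁ : ∀ x y → x - (1ℤ + y) ≡ x - y - 1ℤ
  e₁ = ℤ-Ring.solve-∀
  e₂ : ∀ c → c + 1ℤ - 1ℤ ≡ c
  e₂ = ℤ-Ring.solve-∀
  push : ∀ {s} → WF (suc h) h (c + 1ℤ) s → WF (suc h) (suc h) c (map₂ (h ∷_) s)
  push {x , y} (wf X Y e) = wf X (ℕₚ.≤-refl ∷ All.map ℕₚ.m<n⇒m<1+n Y)
    (trans (e₁ (+ length x) (+ length y)) (trans (cong (_- 1ℤ) e) (e₂ c)))
Od-WF h c w = Allₚ.++⁺ (All.map widen (Ev-WF h c w)) (Allₚ.map⁺ (All.map push (Ev-WF h (c - 1ℤ) _)))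
  where
  widen : ∀ {s} → WF h h c s → WF (suc h) h c s
  widen (wf X Y e) = wf (All.map ℕₚ.m<n⇒m<1+n X) Y e
  e₁ : ∀ x y → 1ℤ + x - y ≡ x - y + 1ℤ
  e₁ = ℤ-Ring.solve-∀
  e₂ : ∀ c → c - 1ℤ + 1ℤ ≡ c
  e₂ = ℤ-Ring.solve-∀
  push : ∀ {s} → WF h h (c - 1ℤ) s → WF (suc h) h c (map₁ (h ∷_) s)
  push {x , y} (wf X Y e) = wf (ℕₚ.≤-refl ∷ All.map ℕₚ.m<n⇒m<1+n X) Y
    (trans (e₁ (+ length x) (+ length y)) (trans (cong (_+ 1ℤ) e) (e₂ c)))

-- Reflection

χ : Bool → ℕ
χ true  = 1
χ false = 0

count : {A : Set} → (A → Bool) → List A → ℕ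
count Q []       = 0
count Q (x ∷ xs) = χ (Q x) ℕ.+ count Q xs

count-++ : {A : Set} (Q : A → Bool) (xs ys : List A) → count Q (xs ++ ys) ≡ count Q xs ℕ.+ count Q ys
count-++ Q []       ys = refl
count-++ Q (x ∷ xs) ys = trans (cong (χ (Q x) ℕ.+_) (count-++ Q xs ys)) (sym (ℕₚ.+-assoc (χ (Q x)) _ _))

count-map : {A B : Set} (Q : B → Bool) (f : A → B) (xs : List A) → count Q (map f xs) ≡ count (Q ∘ f) xs
count-map Q f []       = refl
count-map Q f (x ∷ xs) = cong (χ (Q (f x)) ℕ.+_) (count-map Q f xs)

count-cong : {A : Set} {Q R : A → Bool} {xs : List A} → All (λ x → Q x ≡ R x) xs → count Q xs ≡ count R xs
count-cong []         = refl
count-cong (eq ∷ eqs) = cong₂ ℕ._+_ (cong χ eq) (count-cong eqs)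

count-ext : {A : Set} {Q R : A → Bool} → (∀ x → Q x ≡ R x) → ∀ xs → count Q xs ≡ count R xs
count-ext eq xs = count-cong (All.universal eq xs)

count-replicate : {A : Set} {Q : A → Bool} {x : A} → Q x ≡ false → ∀ k → count Q (replicate k x) ≡ 0
count-replicate eq 0       = refl
count-replicate eq (suc k) = cong₂ ℕ._+_ (cong χ eq) (count-replicate eq k)

count-true : {A : Set} (xs : List A) → count (λ _ → true) xs ≡ length xs
count-true []       = refl
count-true (x ∷ xs) = cong suc (count-true xs)

signs : List ℕ → List ℕ → List Bool
signs (x ∷ X) (y ∷ Y) = ⌊ y ℕ.<? x ⌋ ∷ signs X Y
signs _       _       = []

signs-[]ʳ : ∀ X → signs X [] ≡ []
signs-[]ʳ []      = refl
signs-[]ʳ (x ∷ X) = refl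

<-sign : ∀ {x y} → y ℕ.< x → ⌊ y ℕ.<? x ⌋ ≡ true
<-sign {x} {y} y<x with y ℕ.<? x
... | yes _  = refl
... | no y≮x = contradiction y<x y≮x

≥-sign : ∀ {x y} → x ℕ.≤ y → ⌊ y ℕ.<? x ⌋ ≡ false
≥-sign {x} {y} x≤y with y ℕ.<? x
... | yes y<x = contradiction x≤y (ℕₚ.<⇒≱ y<x)
... | no _    = refl

-- Greedy test for a subsequence f, not f, f, … of length m.
alt : Bool → ℕ → List Bool → Bool
alt f 0       bs       = true
alt f (suc m) []       = false
alt f (suc m) (b ∷ bs) = if f == b then alt (not f) m bs else alt f (suc m) bs

-- The test for `not f` passes over f, so the entry that scores a hit may stay in the list. The
-- column just opened can thus remain pending, as the induction hypothesis requires.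
alt-hit : ∀ f m bs → alt f (suc m) (f ∷ bs) ≡ alt (not f) m (f ∷ bs)
alt-hit true  0       bs = refl
alt-hit true  (suc m) bs = refl
alt-hit false 0       bs = refl
alt-hit false (suc m) bs = refl

-- The charge and weight shifts of the reflected count; the charge shift is
-- d for f = true and − d for f = false.
d : Bool → ℕ → ℕ
d f     0       = 0
d true  (suc m) = suc (suc (d false m))
d false (suc m) = suc (d true m)

δ : Bool → ℕ → ℤ
δ true  m = + d true m
δ false m = - (+ d false m)

e : Bool → ℕ → ℤ
e f     0       = 0ℤ
e true  (suc m) = e false m - 1ℤ + δ false m
e false (suc m) = e true m

altSigns : Bool → ℕ → List ℕ → List ℕ → Strip → Bool
altSigns f m P Q (X , Y) = alt f m (signs (P ++ X) (Q ++ Y))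

count-shift₀ : ∀ {L : ℤ → ℤ → List Strip} f c w P Q →
  count (altSigns f 0 P Q) (L c w) ≡ length (L (c + δ f 0) (w + e f 0))
count-shift₀ {L} f c w P Q = trans (count-true (L c w))
  (cong₂ (λ c w → length (L c w)) (trans (sym (ℤₚ.+-identityʳ c)) (cong (_+_ c) (δ₀ f))) (sym (ℤₚ.+-identityʳ w)))
  where
  δ₀ : ∀ f → 0ℤ ≡ δ f 0
  δ₀ true  = refl
  δ₀ false = refl

length-Od-split : ∀ h c w → length (Od h c w) ≡ length (Ev h c w) ℕ.+ length (Ev h (c - 1ℤ) (w - + h))
length-Od-split h c w = trans (Listₚ.length-++ (Ev h c w)) (cong (length (Ev h c w) ℕ.+_) (Listₚ.length-map _ (Ev h (c - 1ℤ) (w - + h))))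

length-Ev-suc : ∀ h c w → length (Ev (suc h) c w) ≡ length (Od h c w) ℕ.+ length (Od h (c + 1ℤ) (w - + suc h))
length-Ev-suc h c w = trans (Listₚ.length-++ (Od h c w)) (cong (length (Od h c w) ℕ.+_) (Listₚ.length-map _ (Od h (c + 1ℤ) (w - + suc h))))

count-Od-split : ∀ Q h c w → count Q (Od h c w) ≡ count Q (Ev h c w) ℕ.+ count (Q ∘ map₁ (h ∷_)) (Ev h (c - 1ℤ) (w - + h))
count-Od-split Q h c w = trans (count-++ Q (Ev h c w) _) (cong (count Q (Ev h c w) ℕ.+_) (count-map Q _ (Ev h (c - 1ℤ) (w - + h))))

count-Ev-suc : ∀ Q h c w → count Q (Ev (suc h) c w) ≡ count Q (Od h c w) ℕ.+ count (Q ∘ map₂ (h ∷_)) (Od h (c + 1ℤ) (w - + suc h))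
count-Ev-suc Q h c w = trans (count-++ Q (Od h c w) _) (cong (count Q (Od h c w) ℕ.+_) (count-map Q _ (Od h (c + 1ℤ) (w - + suc h))))

private
  +-swapʳ : ∀ c k δ → c + k + δ ≡ c + δ + k
  +-swapʳ = ℤ-Ring.solve-∀

  +length-∷ʳ : ∀ (P : List ℕ) h → + length (P ++ [ h ]) ≡ + length P + 1ℤ
  +length-∷ʳ P h = cong +_ (Listₚ.length-++ P)

  -length-∷ʳ : ∀ (P : List ℕ) h → - (+ length (P ++ [ h ])) ≡ - (+ length P) - 1ℤ
  -length-∷ʳ P h = trans (cong -_ (+length-∷ʳ P h)) (ℤₚ.neg-distrib-+ (+ length P) 1ℤ)

-- The reflection principle.  Entries are read from the top, X against Y; the
-- unmatched ones read so far form the pending list P.  A positive (negative)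
-- column shows up when an entry of X (of Y) is read while nothing is pending
-- on the other side, and at that moment the rest of the symbol is reflected
-- by Ev-refl (Od-refl).
Ev-pos : ∀ h m P w → All (h ℕ.≤_) P →
  count (altSigns true m [] P) (Ev h (+ length P) w) ≡ length (Ev h (+ length P + δ true m) (w + e true m))
Od-pos : ∀ h m P w → All (h ℕ.≤_) P →
  count (altSigns true m [] P) (Od h (+ length P) w) ≡ length (Od h (+ length P + δ true m) (w + e true m))
Ev-pos-hit : ∀ h m z w → h ℕ.≤ z →
  count (altSigns true m [ z ] []) (Ev h (- 1ℤ) w) ≡ length (Ev h (- 1ℤ + δ true m) (w + e true m))
Ev-neg : ∀ h m P w → All (h ℕ.≤_) P →
  count (altSigns false m P []) (Ev h (- (+ length P)) w) ≡ length (Ev h (- (+ length P) + δ false m) (w + e false m))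
Od-neg : ∀ h m P w → All (h ℕ.≤_) P →
  count (altSigns false m P []) (Od h (- (+ length P)) w) ≡ length (Od h (- (+ length P) + δ false m) (w + e false m))
Od-neg-hit : ∀ h m z w → h ℕ.≤ z →
  count (altSigns false m [] [ z ]) (Od h 1ℤ w) ≡ length (Od h (1ℤ + δ false m) (w + e false m))

Ev-pos h 0 P w _ = count-shift₀ {Ev h} true (+ length P) w [] P
-- With no entries left there is no column, and the reflected charge |P| + δ is positive, so both
-- counts are 0.
Ev-pos 0 (suc m) P w _ = trans (count-replicate {Q = altSigns true (suc m) [] P} refl k)
  (sym (trans (Listₚ.length-replicate _) (cong (λ c → unit (+ c) ℕ.* unit (w + e true (suc m))) (ℕₚ.+-suc (length P) _))))
  where k = unit (+ length P) ℕ.* unit w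
Ev-pos (suc h) m@(suc _) P w h<P = begin
  count (altSigns true m [] P) (Ev (suc h) c w)
    ≡⟨ count-Ev-suc _ h c w ⟩
  count (altSigns true m [] P) (Od h c w) ℕ.+ count (altSigns true m [] P ∘ map₂ (h ∷_)) (Od h (c + 1ℤ) (w - + suc h))
    ≡⟨ cong₂ ℕ._+_ (Od-pos h m P w h≤P) matched ⟩
  length (Od h (c + δ true m) (w + e true m)) ℕ.+ length (Od h (c + δ true m + 1ℤ) (w + e true m - + suc h))
    ≡⟨ length-Ev-suc h (c + δ true m) (w + e true m) ⟨
  length (Ev (suc h) (c + δ true m) (w + e true m)) ∎
  where
  open ≡-Reasoning
  c = + length P
  h≤P = All.map ℕₚ.<⇒≤ h<P
  matched : count (altSigns true m [] P ∘ map₂ (h ∷_)) (Od h (c + 1ℤ) (w - + suc h))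
    ≡ length (Od h (c + δ true m + 1ℤ) (w + e true m - + suc h))
  matched = begin
    count (altSigns true m [] P ∘ map₂ (h ∷_)) (Od h (c + 1ℤ) (w - + suc h))
      ≡⟨ count-ext (λ (X , Y) → cong (λ Y → alt true m (signs X Y)) (sym (Listₚ.++-assoc P [ h ] Y))) (Od h (c + 1ℤ) _) ⟩
    count (altSigns true m [] (P ++ [ h ])) (Od h (c + 1ℤ) (w - + suc h))
      ≡⟨ cong (λ c → count (altSigns true m [] (P ++ [ h ])) (Od h c (w - + suc h))) (+length-∷ʳ P h) ⟨
    count (altSigns true m [] (P ++ [ h ])) (Od h (+ length (P ++ [ h ])) (w - + suc h))
      ≡⟨ Od-pos h m (P ++ [ h ]) _ (Allₚ.++⁺ h≤P (ℕₚ.≤-refl ∷ [])) ⟩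
    length (Od h (+ length (P ++ [ h ]) + δ true m) (w - + suc h + e true m))
      ≡⟨ cong₂ (λ c w → length (Od h c w)) (trans (cong (_+ δ true m) (+length-∷ʳ P h)) (+-swapʳ c 1ℤ (δ true m)))
           (+-swapʳ w (- (+ suc h)) (e true m)) ⟩
    length (Od h (c + δ true m + 1ℤ) (w + e true m - + suc h)) ∎

Od-pos h 0 P w _ = count-shift₀ {Od h} true (+ length P) w [] P
Od-pos h m@(suc _) P w h≤P = begin
  count (altSigns true m [] P) (Od h c w)
    ≡⟨ count-Od-split _ h c w ⟩
  count (altSigns true m [] P) (Ev h c w) ℕ.+ count (altSigns true m [] P ∘ map₁ (h ∷_)) (Ev h (c - 1ℤ) (w - + h))
    ≡⟨ cong₂ ℕ._+_ (Ev-pos h m P w h≤P) (trans (matched P h≤P)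
         (cong₂ (λ c w → length (Ev h c w)) (+-swapʳ c (- 1ℤ) (δ true m)) (+-swapʳ w (- (+ h)) (e true m)))) ⟩
  length (Ev h (c + δ true m) (w + e true m)) ℕ.+ length (Ev h (c + δ true m - 1ℤ) (w + e true m - + h))
    ≡⟨ length-Od-split h (c + δ true m) (w + e true m) ⟨
  length (Od h (c + δ true m) (w + e true m)) ∎
  where
  open ≡-Reasoning
  c = + length P
  -- The X-entry h completes a negative column with the first pending Y-entry, and the test for
  -- `true` skips it. If none is pending, h opens a column that is bound to be positive: the path
  -- visits 1.
  matched : ∀ P → All (h ℕ.≤_) P → count (altSigns true m [] P ∘ map₁ (h ∷_)) (Ev h (+ length P - 1ℤ) (w - + h))
    ≡ length (Ev h (+ length P - 1ℤ + δ true m) (w - + h + e true m))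
  matched []      _         = Ev-pos-hit h m h (w - + h) ℕₚ.≤-refl
  matched (p ∷ P) (h≤p ∷ h≤P) = trans
    (count-ext (λ (X , Y) → cong (λ b → alt true m (b ∷ signs X (P ++ Y))) (≥-sign h≤p)) (Ev h (+ length P) _))
    (Ev-pos h m P (w - + h) h≤P)

Ev-pos-hit h 0 z w _ = count-shift₀ {Ev h} true (- 1ℤ) w [ z ] []
Ev-pos-hit h (suc m) z w h≤z = begin
  count (altSigns true (suc m) [ z ] []) (Ev h (- 1ℤ) w)
    ≡⟨ count-cong (All.map hit (Ev-WF h (- 1ℤ) w)) ⟩
  count (altSigns false m [ z ] []) (Ev h (- 1ℤ) w)
    ≡⟨ Ev-neg h m [ z ] w (h≤z ∷ []) ⟩
  length (Ev h (- 1ℤ + δ false m) (w + e false m))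
    -- The later hits are already reflected, so a full `Ev` is left. Its charge -1 - d becomes 1 + d
    -- = -1 + (d + 2), whence the recursion of `d true`; its old charge is the weight shift -1 + δ
    -- in `e`.
    ≡⟨ Ev-refl h _ _ ⟩
  length (Ev h (- (- 1ℤ + δ false m)) (w + e false m + (- 1ℤ + δ false m)))
    ≡⟨ cong₂ (λ c w → length (Ev h c w)) (e₁ (+ d false m)) (e₂ w (e false m) (δ false m)) ⟩
  length (Ev h (- 1ℤ + δ true (suc m)) (w + e true (suc m))) ∎
  where
  open ≡-Reasoning
  hit : ∀ {s} → WF h h (- 1ℤ) s → altSigns true (suc m) [ z ] [] s ≡ altSigns false m [ z ] [] s
  hit {X , []} (wf _ _ ())
  hit {X , y ∷ Y} (wf _ (y<h ∷ _) _) rewrite <-sign (ℕₚ.<-≤-trans y<h h≤z) = alt-hit true m (signs X Y)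
  e₁ : ∀ d → - (- 1ℤ + - d) ≡ - 1ℤ + (1ℤ + (1ℤ + d))
  e₁ = ℤ-Ring.solve-∀
  e₂ : ∀ w e d → w + e + (- 1ℤ + d) ≡ w + (e - 1ℤ + d)
  e₂ = ℤ-Ring.solve-∀

Ev-neg h 0 P w _ = count-shift₀ {Ev h} false (- (+ length P)) w P []
Ev-neg 0 (suc m) P w _ = trans (count-replicate {Q = altSigns false (suc m) P []} (cong (alt false (suc m)) (signs-[]ʳ (P ++ []))) k)
  (sym (trans (Listₚ.length-replicate _) (cong (ℕ._* unit (w + e false (suc m))) (negative (length P)))))
  where
  k = unit (- (+ length P)) ℕ.* unit w
  negative : ∀ n → unit (- (+ n) + δ false (suc m)) ≡ 0
  negative 0       = refl
  negative (suc n) = refl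
Ev-neg (suc h) m@(suc _) P w h<P = begin
  count (altSigns false m P []) (Ev (suc h) c w)
    ≡⟨ count-Ev-suc _ h c w ⟩
  count (altSigns false m P []) (Od h c w) ℕ.+ count (altSigns false m P [] ∘ map₂ (h ∷_)) (Od h (c + 1ℤ) (w - + suc h))
    ≡⟨ cong₂ ℕ._+_ (Od-neg h m P w (All.map ℕₚ.<⇒≤ h<P)) (trans (matched P h<P)
         (cong₂ (λ c w → length (Od h c w)) (+-swapʳ c 1ℤ (δ false m)) (+-swapʳ w (- (+ suc h)) (e false m)))) ⟩
  length (Od h (c + δ false m) (w + e false m)) ℕ.+ length (Od h (c + δ false m + 1ℤ) (w + e false m - + suc h))
    ≡⟨ length-Ev-suc h (c + δ false m) (w + e false m) ⟨
  length (Ev (suc h) (c + δ false m) (w + e false m)) ∎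
  where
  open ≡-Reasoning
  c = - (+ length P)
  e₁ : ∀ n → - (1ℤ + n) + 1ℤ ≡ - n
  e₁ = ℤ-Ring.solve-∀
  matched : ∀ P → All (h ℕ.<_) P → count (altSigns false m P [] ∘ map₂ (h ∷_)) (Od h (- (+ length P) + 1ℤ) (w - + suc h))
    ≡ length (Od h (- (+ length P) + 1ℤ + δ false m) (w - + suc h + e false m))
  matched []      _           = Od-neg-hit h m h (w - + suc h) ℕₚ.≤-refl
  -- Strictness matters: the Y-entry h is read before the X-entry h, so pending X-entries exceed h
  -- and the completed column is positive. A column with equal entries is met from its Y side and
  -- counts as negative.
  matched (p ∷ P) (h<p ∷ h<P) rewrite e₁ (+ length P) = trans
    (count-ext (λ (X , Y) → cong (λ b → alt false m (b ∷ signs (P ++ X) Y)) (<-sign h<p)) (Od h (- (+ length P)) _))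
    (Od-neg h m P (w - + suc h) (All.map ℕₚ.<⇒≤ h<P))

Od-neg h 0 P w _ = count-shift₀ {Od h} false (- (+ length P)) w P []
Od-neg h m@(suc _) P w h≤P = begin
  count (altSigns false m P []) (Od h c w)
    ≡⟨ count-Od-split _ h c w ⟩
  count (altSigns false m P []) (Ev h c w) ℕ.+ count (altSigns false m P [] ∘ map₁ (h ∷_)) (Ev h (c - 1ℤ) (w - + h))
    ≡⟨ cong₂ ℕ._+_ (Ev-neg h m P w h≤P) matched ⟩
  length (Ev h (c + δ false m) (w + e false m)) ℕ.+ length (Ev h (c + δ false m - 1ℤ) (w + e false m - + h))
    ≡⟨ length-Od-split h (c + δ false m) (w + e false m) ⟨
  length (Od h (c + δ false m) (w + e false m)) ∎
  where
  open ≡-Reasoning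
  c = - (+ length P)
  matched : count (altSigns false m P [] ∘ map₁ (h ∷_)) (Ev h (c - 1ℤ) (w - + h))
    ≡ length (Ev h (c + δ false m - 1ℤ) (w + e false m - + h))
  matched = begin
    count (altSigns false m P [] ∘ map₁ (h ∷_)) (Ev h (c - 1ℤ) (w - + h))
      ≡⟨ count-ext (λ (X , Y) → cong (λ X → alt false m (signs X Y)) (sym (Listₚ.++-assoc P [ h ] X))) (Ev h (c - 1ℤ) _) ⟩
    count (altSigns false m (P ++ [ h ]) []) (Ev h (c - 1ℤ) (w - + h))
      ≡⟨ cong (λ c → count (altSigns false m (P ++ [ h ]) []) (Ev h c (w - + h))) (-length-∷ʳ P h) ⟨
    count (altSigns false m (P ++ [ h ]) []) (Ev h (- (+ length (P ++ [ h ]))) (w - + h))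
      ≡⟨ Ev-neg h m (P ++ [ h ]) _ (Allₚ.++⁺ h≤P (ℕₚ.≤-refl ∷ [])) ⟩
    length (Ev h (- (+ length (P ++ [ h ])) + δ false m) (w - + h + e false m))
      ≡⟨ cong₂ (λ c w → length (Ev h c w)) (trans (cong (_+ δ false m) (-length-∷ʳ P h)) (+-swapʳ c (- 1ℤ) (δ false m)))
           (+-swapʳ w (- (+ h)) (e false m)) ⟩
    length (Ev h (c + δ false m - 1ℤ) (w + e false m - + h)) ∎

Od-neg-hit h 0 z w _ = count-shift₀ {Od h} false 1ℤ w [] [ z ]
Od-neg-hit h (suc m) z w h≤z = begin
  count (altSigns false (suc m) [] [ z ]) (Od h 1ℤ w)
    ≡⟨ count-cong (All.map hit (Od-WF h 1ℤ w)) ⟩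
  count (altSigns true m [] [ z ]) (Od h 1ℤ w)
    ≡⟨ Od-pos h m [ z ] w (h≤z ∷ []) ⟩
  length (Od h (1ℤ + δ true m) (w + e true m))
    -- The charge 1 + d becomes -d = 1 - (d + 1) and the weight stays, so `d false` adds 1 and
    -- `e false` adds nothing.
    ≡⟨ Od-refl h _ _ ⟩
  length (Od h (1ℤ - (1ℤ + δ true m)) (w + e true m))
    ≡⟨ cong (λ c → length (Od h c (w + e true m))) (e₁ (+ d true m)) ⟩
  length (Od h (1ℤ + δ false (suc m)) (w + e false (suc m))) ∎
  where
  open ≡-Reasoning
  hit : ∀ {s} → WF (suc h) h 1ℤ s → altSigns false (suc m) [] [ z ] s ≡ altSigns true m [] [ z ] s
  hit {[] , []} (wf _ _ ())
  hit {[] , _ ∷ _} (wf _ _ ())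
  hit {x ∷ X , Y} (wf (x≤h ∷ _) _ _) rewrite ≥-sign (ℕₚ.≤-trans (ℕₚ.≤-pred x≤h) h≤z) = alt-hit false m (signs X Y)
  e₁ : ∀ d → 1ℤ - (1ℤ + d) ≡ 1ℤ + - (1ℤ + d)
  e₁ = ℤ-Ring.solve-∀

-- Partitions

g-negative : ∀ t i w → g t -[1+ i ] w ≡ 0
g-negative 0       i w = refl
g-negative (suc t) i w = cong₂ ℕ._+_ (g-negative t i w) (g-negative t _ _)

g-zero : ∀ t w → g t 0ℤ w ≡ unit w
g-zero 0       w = ℕₚ.+-identityʳ (unit w)
g-zero (suc t) w = trans (cong₂ ℕ._+_ (g-zero t w) (g-negative t _ _)) (ℕₚ.+-identityʳ (unit w))

g-top : ∀ t w → g t (+ t) w ≡ unit w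
g-top t w = trans (g-sym t (+ t) w) (trans (cong (λ i → g t i w) (ℤₚ.+-inverseʳ (+ t))) (g-zero t w))

-- Pascal's rule by box sides: either all parts are at most j, or a part `suc j` is removed and at
-- most i parts remain.
g-box : ∀ i j w → g (suc i ℕ.+ suc j) (+ suc i) w ≡ g (suc i ℕ.+ j) (+ suc i) w ℕ.+ g (i ℕ.+ suc j) (+ i) (w - + suc j)
g-box i j w = cong₂ ℕ._+_ (cong (λ t → g t (+ suc i) w) (ℕₚ.+-suc i j))
  (cong (λ u → g (i ℕ.+ suc j) (+ i) (w - u)) (e₁ (+ i) (+ j)))
  where
  e₁ : ∀ i j → 1ℤ + (i + (1ℤ + j)) - (1ℤ + i) ≡ 1ℤ + j
  e₁ = ℤ-Ring.solve-∀

g-negative-weight : ∀ i j n → g (i ℕ.+ j) (+ i) -[1+ n ] ≡ 0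
g-negative-weight 0       j       n = g-zero j -[1+ n ]
g-negative-weight (suc i) 0       n = trans (cong (λ t → g t (+ suc i) -[1+ n ]) (ℕₚ.+-identityʳ (suc i))) (g-top (suc i) _)
g-negative-weight (suc i) (suc j) n = trans (g-box i j -[1+ n ])
  (cong₂ ℕ._+_ (g-negative-weight (suc i) j n) (g-negative-weight i (suc j) _))

private
  +m-+n : ∀ {m n} → n ℕ.≤ m → + m - + n ≡ + (m ℕ.∸ n)
  +m-+n {m} {n} n≤m = trans (ℤₚ.m-n≡m⊖n m n) (ℤₚ.⊖-≥ n≤m)

  filter-∷ʳ-yes : ∀ n k xs → k ℕ.≤ n → filter (ℕ._≤? n) (xs ++ [ k ]) ≡ filter (ℕ._≤? n) xs ++ [ k ]
  filter-∷ʳ-yes n k xs k≤n = trans (Listₚ.filter-++ (ℕ._≤? n) xs [ k ]) (cong (filter (ℕ._≤? n) xs ++_) (Listₚ.filter-accept (ℕ._≤? n) k≤n))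

  filter-∷ʳ-no : ∀ n k xs → ¬ (k ℕ.≤ n) → filter (ℕ._≤? n) (xs ++ [ k ]) ≡ filter (ℕ._≤? n) xs
  filter-∷ʳ-no n k xs k≰n = trans (Listₚ.filter-++ (ℕ._≤? n) xs [ k ])
    (trans (cong (filter (ℕ._≤? n) xs ++_) (Listₚ.filter-reject (ℕ._≤? n) k≰n)) (Listₚ.++-identityʳ _))

-- First parts are tried in increasing order, so a larger bound appends the partitions with the new
-- first part. This is the list form of `g-box`.
partsLE-suc : ∀ f k n → k ℕ.≤ n →
  partsLE (suc f) (suc k) (suc n) ≡ partsLE (suc f) k (suc n) ++ map (suc k ∷_) (partsLE f (suc k) (n ℕ.∸ k))
partsLE-suc f k n k≤n = begin
  concatMap F (filter (ℕ._≤? suc n) (applyUpTo suc (suc k)))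
    ≡⟨ cong (concatMap F ∘ filter (ℕ._≤? suc n)) (Listₚ.applyUpTo-∷ʳ suc k) ⟨
  concatMap F (filter (ℕ._≤? suc n) (applyUpTo suc k ++ [ suc k ]))
    ≡⟨ cong (concatMap F) (filter-∷ʳ-yes (suc n) (suc k) (applyUpTo suc k) (ℕ.s≤s k≤n)) ⟩
  concatMap F (filter (ℕ._≤? suc n) (applyUpTo suc k) ++ [ suc k ])
    ≡⟨ Listₚ.concatMap-++ F (filter (ℕ._≤? suc n) (applyUpTo suc k)) [ suc k ] ⟩
  partsLE (suc f) k (suc n) ++ (F (suc k) ++ [])
    ≡⟨ cong (partsLE (suc f) k (suc n) ++_) (Listₚ.++-identityʳ (F (suc k))) ⟩
  partsLE (suc f) k (suc n) ++ F (suc k) ∎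
  where
  open ≡-Reasoning
  F : ℕ → List (List ℕ)
  F j = map (j ∷_) (partsLE f j (suc n ℕ.∸ j))

partsLE-big : ∀ f k n → n ℕ.≤ k → partsLE f (suc k) n ≡ partsLE f k n
partsLE-big f       k 0       _   = refl
partsLE-big 0       k (suc n) _   = refl
partsLE-big (suc f) k (suc n) n<k = trans
  (cong (concatMap F ∘ filter (ℕ._≤? suc n)) (sym (Listₚ.applyUpTo-∷ʳ suc k)))
  (cong (concatMap F) (filter-∷ʳ-no (suc n) (suc k) (applyUpTo suc k) (ℕₚ.<⇒≱ (ℕ.s≤s n<k))))
  where
  F : ℕ → List (List ℕ)
  F j = map (j ∷_) (partsLE f j (suc n ℕ.∸ j))

partsLE-saturated : ∀ f n x → partsLE f (x ℕ.+ n) n ≡ partsLE f n n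
partsLE-saturated f n 0       = refl
partsLE-saturated f n (suc x) = trans (partsLE-big f (x ℕ.+ n) n (ℕₚ.m≤n+m n x)) (partsLE-saturated f n x)

-- As n ≤ i, the limit on the number of parts never binds, and `g-box` and `partsLE-suc` become the
-- same recursion on the largest part allowed.
g-partsLE : ∀ f i j n → n ℕ.≤ i → n ℕ.≤ f → g (i ℕ.+ j) (+ i) (+ n) ≡ length (partsLE f j n)
g-partsLE f i 0 n n≤i n≤f = trans (cong (λ t → g t (+ i) (+ n)) (ℕₚ.+-identityʳ i)) (trans (g-top i (+ n)) (no-parts f n n≤f))
  where
  no-parts : ∀ f n → n ℕ.≤ f → unit (+ n) ≡ length (partsLE f 0 n)
  no-parts f       0       _ = refl
  no-parts (suc f) (suc n) _ = refl
g-partsLE f 0       (suc j) 0 _ _ = g-zero (suc j) 0ℤ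
g-partsLE f (suc i) (suc j) 0 _ _ = trans (g-box i j 0ℤ)
  (cong₂ ℕ._+_ (g-partsLE f (suc i) j 0 ℕ.z≤n ℕ.z≤n) (g-negative-weight i (suc j) j))
g-partsLE (suc f) (suc i) (suc j) (suc n) (ℕ.s≤s n≤i) (ℕ.s≤s n≤f) with j ℕ.≤? n
... | yes j≤n = begin
  g (suc i ℕ.+ suc j) (+ suc i) (+ suc n)
    ≡⟨ g-box i j (+ suc n) ⟩
  g (suc i ℕ.+ j) (+ suc i) (+ suc n) ℕ.+ g (i ℕ.+ suc j) (+ i) (+ suc n - + suc j)
    ≡⟨ cong₂ ℕ._+_ (g-partsLE (suc f) (suc i) j (suc n) (ℕ.s≤s n≤i) (ℕ.s≤s n≤f))
         (trans (cong (g (i ℕ.+ suc j) (+ i)) (+m-+n (ℕ.s≤s j≤n)))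
           (g-partsLE f i (suc j) (n ℕ.∸ j) (ℕₚ.≤-trans (ℕₚ.m∸n≤m n j) n≤i) (ℕₚ.≤-trans (ℕₚ.m∸n≤m n j) n≤f))) ⟩
  length (partsLE (suc f) j (suc n)) ℕ.+ length (partsLE f (suc j) (n ℕ.∸ j))
    ≡⟨ cong (length (partsLE (suc f) j (suc n)) ℕ.+_) (Listₚ.length-map _ (partsLE f (suc j) (n ℕ.∸ j))) ⟨
  length (partsLE (suc f) j (suc n)) ℕ.+ length (map (suc j ∷_) (partsLE f (suc j) (n ℕ.∸ j)))
    ≡⟨ Listₚ.length-++ (partsLE (suc f) j (suc n)) ⟨
  length (partsLE (suc f) j (suc n) ++ map (suc j ∷_) (partsLE f (suc j) (n ℕ.∸ j)))
    ≡⟨ cong length (partsLE-suc f j n j≤n) ⟨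
  length (partsLE (suc f) (suc j) (suc n)) ∎
  where open ≡-Reasoning
... | no j≰n = begin
  g (suc i ℕ.+ suc j) (+ suc i) (+ suc n)
    ≡⟨ g-box i j (+ suc n) ⟩
  g (suc i ℕ.+ j) (+ suc i) (+ suc n) ℕ.+ g (i ℕ.+ suc j) (+ i) (+ suc n - + suc j)
    ≡⟨ cong₂ ℕ._+_ (g-partsLE (suc f) (suc i) j (suc n) (ℕ.s≤s n≤i) (ℕ.s≤s n≤f))
         (trans (cong (g (i ℕ.+ suc j) (+ i)) (deficit (ℕₚ.≰⇒> j≰n))) (g-negative-weight i (suc j) _)) ⟩
  length (partsLE (suc f) j (suc n)) ℕ.+ 0
    ≡⟨ ℕₚ.+-identityʳ _ ⟩
  length (partsLE (suc f) j (suc n))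
    ≡⟨ cong length (partsLE-big (suc f) j (suc n) (ℕₚ.≰⇒> j≰n)) ⟨
  length (partsLE (suc f) (suc j) (suc n)) ∎
  where
  open ≡-Reasoning
  deficit : ∀ {n j} → n ℕ.< j → + suc n - + suc j ≡ -[1+ j ℕ.∸ suc n ]
  deficit {n} {j} n<j = trans (ℤₚ.m-n≡m⊖n (suc n) (suc j)) (trans (ℤₚ.⊖-< (ℕ.s≤s n<j)) (cong (λ k → - (+ k)) (ℕₚ.+-∸-assoc 1 n<j)))

-- The box has to be large only for v ≥ 0; a negative weight gives 0 on both sides, in line with
-- p(k) = 0 for k < 0.
g-pℤ : ∀ i j v → (∀ n → v ≡ + n → n ℕ.≤ i × n ℕ.≤ j) → + g (i ℕ.+ j) (+ i) v ≡ pℤ v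
g-pℤ i j -[1+ n ] _ = cong +_ (g-negative-weight i j n)
g-pℤ i j (+ n) fits with fits n refl
... | n≤i , n≤j = cong +_ (trans (g-partsLE n i j n n≤i ℕₚ.≤-refl)
  (cong length (trans (cong (λ k → partsLE n k n) (sym (ℕₚ.m∸n+n≡m n≤j))) (partsLE-saturated n n (j ℕ.∸ n)))))

data Decreasing : ℕ → List ℕ → Set where
  []  : ∀ {k} → Decreasing k []
  _∷_ : ∀ {k x xs} → x ℕ.≤ k → Decreasing x xs → Decreasing k (x ∷ xs)

record IsPartition (k n : ℕ) (xs : List ℕ) : Set where
  constructor isPartition
  field
    decreasing : Decreasing k xs
    positive   : All (1 ℕ.≤_) xs
    total      : sum xs ≡ n

widen : ∀ {k xs} → Decreasing k xs → Decreasing (suc k) xs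
widen []         = []
widen (x≤k ∷ xs) = ℕₚ.m≤n⇒m≤1+n x≤k ∷ xs

partsLE-isPartition : ∀ f k n → All (IsPartition k n) (partsLE f k n)
partsLE-isPartition f k 0 = isPartition [] [] refl ∷ []
partsLE-isPartition 0 k (suc n) = []
partsLE-isPartition (suc f) 0 (suc n) = []
partsLE-isPartition (suc f) (suc k) (suc n) with k ℕ.≤? n
... | yes k≤n = subst (All _) (sym (partsLE-suc f k n k≤n)) (Allₚ.++⁺
  (All.map (λ (isPartition d p t) → isPartition (widen d) p t) (partsLE-isPartition (suc f) k (suc n)))
  (Allₚ.map⁺ (All.map (λ (isPartition d p t) → isPartition (ℕₚ.≤-refl ∷ d) (ℕ.s≤s ℕ.z≤n ∷ p)
    (cong suc (trans (cong (k ℕ.+_) t) (ℕₚ.m+[n∸m]≡n k≤n)))) (partsLE-isPartition f (suc k) (n ℕ.∸ k)))))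
... | no k≰n = subst (All _) (sym (partsLE-big (suc f) k (suc n) (ℕₚ.≰⇒> k≰n)))
  (All.map (λ (isPartition d p t) → isPartition (widen d) p t) (partsLE-isPartition (suc f) k (suc n)))

partsLE-unique : ∀ f k n → Unique (partsLE f k n)
partsLE-unique f k 0 = [] ∷ []
partsLE-unique 0 k (suc n) = []
partsLE-unique (suc f) 0 (suc n) = []
partsLE-unique (suc f) (suc k) (suc n) with k ℕ.≤? n
... | yes k≤n = subst Unique (sym (partsLE-suc f k n k≤n)) (Uniqueₚ.++⁺
  (partsLE-unique (suc f) k (suc n)) (Uniqueₚ.map⁺ Listₚ.∷-injectiveʳ (partsLE-unique f (suc k) (n ℕ.∸ k))) disjoint)
  where
  disjoint : ∀ {xs} → xs ∈ partsLE (suc f) k (suc n) × xs ∈ map (suc k ∷_) (partsLE f (suc k) (n ℕ.∸ k)) → _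
  disjoint (xs∈ , xs∈′) with All.lookup (partsLE-isPartition (suc f) k (suc n)) xs∈ | ∈-map⁻ (suc k ∷_) xs∈′
  ... | isPartition (k<k ∷ _) _ _ | _ , _ , refl = ℕₚ.1+n≰n k<k
... | no k≰n = subst Unique (sym (partsLE-big (suc f) k (suc n) (ℕₚ.≰⇒> k≰n))) (partsLE-unique (suc f) k (suc n))

-- The Frobenius symbol of a partition

length-filter-map : {A B : Set} {P : A → Set} {Q : B → Set} (P? : Decidable P) (Q? : Decidable Q) (f : A → B) →
  (∀ x → P x → Q (f x)) → (∀ x → Q (f x) → P x) → ∀ xs → length (filter Q? (map f xs)) ≡ length (filter P? xs)
length-filter-map P? Q? f to from []       = refl
length-filter-map P? Q? f to from (x ∷ xs) with P? x | Q? (f x)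
... | yes _  | yes _  = cong suc (length-filter-map P? Q? f to from xs)
... | no _   | no _   = length-filter-map P? Q? f to from xs
... | yes px | no ¬q  = contradiction (to x px) ¬q
... | no ¬p  | yes qx = contradiction (from x qx) ¬p

part-pred : ∀ xs i → part (map ℕ.pred xs) i ≡ ℕ.pred (part xs i)
part-pred []       i             = refl
part-pred (x ∷ xs) 0             = refl
part-pred (x ∷ xs) 1             = refl
part-pred (x ∷ xs) (suc (suc i)) = part-pred xs (suc i)

part-zeros : ∀ {xs} → All (_≡ 0) xs → ∀ i → part xs i ≡ 0
part-zeros []          i             = refl
part-zeros (refl ∷ zs) 0             = refl
part-zeros (refl ∷ zs) 1             = refl
part-zeros (refl ∷ zs) (suc (suc i)) = part-zeros zs (suc i)

conj-pred : ∀ xs i → conj (map ℕ.pred xs) (suc i) ≡ conj xs (suc (suc i))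
conj-pred xs i = length-filter-map (suc (suc i) ℕ.≤?_) (suc i ℕ.≤?_) ℕ.pred
  (λ { (suc x) (ℕ.s≤s le) → le }) (λ { (suc x) le → ℕ.s≤s le }) xs

private
  applyUpTo-2+ : ∀ n → applyUpTo (suc ∘ suc) n ≡ map suc (applyUpTo suc n)
  applyUpTo-2+ n = sym (Listₚ.map-applyUpTo suc suc n)

durfee-zeros : ∀ {xs} → All (_≡ 0) xs → durfee xs ≡ 0
durfee-zeros {xs} zs = cong length (Listₚ.filter-none (λ i → i ℕ.≤? part xs i)
  (Allₚ.applyUpTo⁺₁ suc (length xs) λ {i} _ le → contradiction (subst (suc i ℕ.≤_) (part-zeros zs (suc i)) le) λ ()))

durfee-hook : ∀ x xs → durfee (suc x ∷ xs) ≡ suc (durfee (map ℕ.pred xs))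
durfee-hook x xs = cong suc (begin
  length (filter Q? (applyUpTo (suc ∘ suc) (length xs)))
    ≡⟨ cong (length ∘ filter Q?) (applyUpTo-2+ (length xs)) ⟩
  length (filter Q? (map suc (applyUpTo suc (length xs))))
    ≡⟨ length-filter-map P? Q? suc to from (applyUpTo suc (length xs)) ⟩
  length (filter P? (applyUpTo suc (length xs)))
    ≡⟨ cong (λ n → length (filter P? (applyUpTo suc n))) (Listₚ.length-map ℕ.pred xs) ⟨
  durfee (map ℕ.pred xs) ∎)
  where
  open ≡-Reasoning
  P? = λ i → i ℕ.≤? part (map ℕ.pred xs) i
  Q? = λ i → i ℕ.≤? part (suc x ∷ xs) i
  to : ∀ i → i ℕ.≤ part (map ℕ.pred xs) i → suc i ℕ.≤ part (suc x ∷ xs) (suc i)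
  to 0       _  = ℕ.s≤s ℕ.z≤n
  to (suc i) le with part xs (suc i) | subst (suc i ℕ.≤_) (part-pred xs (suc i)) le
  ... | suc _ | le′ = ℕ.s≤s le′
  from : ∀ i → suc i ℕ.≤ part (suc x ∷ xs) (suc i) → i ℕ.≤ part (map ℕ.pred xs) i
  from 0       _  = ℕ.z≤n
  from (suc i) le = subst (suc i ℕ.≤_) (sym (part-pred xs (suc i))) (ℕₚ.pred-mono-≤ le)

decreasing-zeros : ∀ {xs} → Decreasing 0 xs → All (_≡ 0) xs
decreasing-zeros []            = []
decreasing-zeros (ℕ.z≤n ∷ dec) = refl ∷ decreasing-zeros dec

decreasing-pred : ∀ {k xs} → Decreasing k xs → Decreasing (ℕ.pred k) (map ℕ.pred xs)
decreasing-pred []          = []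
decreasing-pred (x≤k ∷ dec) = ℕₚ.pred-mono-≤ x≤k ∷ decreasing-pred dec

length-pred : ∀ {f} xs → length xs ℕ.≤ f → length (map ℕ.pred xs) ℕ.≤ f
length-pred xs = subst (ℕ._≤ _) (sym (Listₚ.length-map ℕ.pred xs))

-- Bounds the diagonal by the largest part, for use in `frobY-hook`. The argument `f` bounds the
-- length and carries the recursion, since `map ℕ.pred xs` is not structurally smaller.
durfee-≤ : ∀ f {k} xs → length xs ℕ.≤ f → Decreasing k xs → durfee xs ℕ.≤ k
durfee-≤ f       []           _          _           = ℕ.z≤n
durfee-≤ f       {k} (0 ∷ xs) _          (_ ∷ dec)   =
  subst (ℕ._≤ k) (sym (durfee-zeros (refl ∷ decreasing-zeros dec))) ℕ.z≤n
durfee-≤ (suc f) {k} (suc x ∷ xs) (ℕ.s≤s le) (x<k ∷ dec) =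
  subst (ℕ._≤ k) (sym (durfee-hook x xs))
    (ℕₚ.≤-trans (ℕ.s≤s (durfee-≤ f (map ℕ.pred xs) (length-pred xs le) (decreasing-pred dec))) x<k)

-- The Frobenius symbol obtained by stripping hooks: the outermost hook of
-- suc x ∷ xs has arm x and leg conj xs 1, and its removal leaves map pred xs,
-- in which zero parts are kept.
data Hooks : List ℕ → List ℕ → List ℕ → Set where
  flat : ∀ {xs} → All (_≡ 0) xs → Hooks xs [] []
  hook : ∀ {x xs y X Y} → y ≡ conj xs 1 → Hooks (map ℕ.pred xs) X Y → Hooks (suc x ∷ xs) (x ∷ X) (y ∷ Y)

private
  frobX-of frobY-of : List ℕ → ℕ → List ℕ
  frobX-of xs n = map (λ i → part xs i ℕ.∸ i) (applyUpTo suc n)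
  frobY-of xs n = map (λ i → conj xs i ℕ.∸ i) (applyUpTo suc n)

frobX-hook : ∀ x xs → frobX (suc x ∷ xs) ≡ x ∷ frobX (map ℕ.pred xs)
frobX-hook x xs = begin
  frobX-of (suc x ∷ xs) (durfee (suc x ∷ xs))   ≡⟨ cong (frobX-of (suc x ∷ xs)) (durfee-hook x xs) ⟩
  x ∷ map F (applyUpTo (suc ∘ suc) n)           ≡⟨ cong (λ is → x ∷ map F is) (applyUpTo-2+ n) ⟩
  x ∷ map F (map suc (applyUpTo suc n))         ≡⟨ cong (x ∷_) (Listₚ.map-∘ (applyUpTo suc n)) ⟨
  x ∷ map (F ∘ suc) (applyUpTo suc n)           ≡⟨ cong (x ∷_) (Listₚ.map-cong-local (Allₚ.applyUpTo⁺₁ suc n λ {i} _ → entry i)) ⟩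
  x ∷ frobX (map ℕ.pred xs)                     ∎
  where
  open ≡-Reasoning
  n = durfee (map ℕ.pred xs)
  F = λ i → part (suc x ∷ xs) i ℕ.∸ i
  entry : ∀ i → part xs (suc i) ℕ.∸ suc (suc i) ≡ part (map ℕ.pred xs) (suc i) ℕ.∸ suc i
  entry i rewrite part-pred xs (suc i) with part xs (suc i)
  ... | 0     = refl
  ... | suc _ = refl

frobY-hook : ∀ x xs → Decreasing (suc x) xs → frobY (suc x ∷ xs) ≡ conj xs 1 ∷ frobY (map ℕ.pred xs)
frobY-hook x xs dec = begin
  frobY-of (suc x ∷ xs) (durfee (suc x ∷ xs))     ≡⟨ cong (frobY-of (suc x ∷ xs)) (durfee-hook x xs) ⟩
  y ∷ map F (applyUpTo (suc ∘ suc) n)             ≡⟨ cong (λ is → y ∷ map F is) (applyUpTo-2+ n) ⟩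
  y ∷ map F (map suc (applyUpTo suc n))           ≡⟨ cong (y ∷_) (Listₚ.map-∘ (applyUpTo suc n)) ⟨
  y ∷ map (F ∘ suc) (applyUpTo suc n)
    ≡⟨ cong (y ∷_) (Listₚ.map-cong-local (Allₚ.applyUpTo⁺₁ suc n λ {i} i<n → entry i (ℕₚ.<-≤-trans i<n n≤x))) ⟩
  y ∷ frobY (map ℕ.pred xs)                       ∎
  where
  open ≡-Reasoning
  n = durfee (map ℕ.pred xs)
  y = conj xs 1
  F = λ i → conj (suc x ∷ xs) i ℕ.∸ i
  n≤x : n ℕ.≤ x
  n≤x = durfee-≤ _ (map ℕ.pred xs) ℕₚ.≤-refl (decreasing-pred dec)
  -- The first row reaches column i + 2 because i < x. It adds 1 to the length of that column, which
  -- cancels one unit of the index.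
  entry : ∀ i → i ℕ.< x → conj (suc x ∷ xs) (suc (suc i)) ℕ.∸ suc (suc i) ≡ conj (map ℕ.pred xs) (suc i) ℕ.∸ suc i
  entry i i<x = trans
    (cong (λ zs → length zs ℕ.∸ suc (suc i)) (Listₚ.filter-accept (suc (suc i) ℕ.≤?_) (ℕ.s≤s i<x)))
    (cong (ℕ._∸ suc i) (sym (conj-pred xs i)))

hooks-flat : ∀ {xs} → All (_≡ 0) xs → Hooks xs (frobX xs) (frobY xs)
hooks-flat {xs} zs = subst (λ n → Hooks xs (frobX-of xs n) (frobY-of xs n)) (sym (durfee-zeros zs)) (flat zs)

hooks-frob : ∀ f {k} xs → length xs ℕ.≤ f → Decreasing k xs → Hooks xs (frobX xs) (frobY xs)
hooks-frob f       []           _          _         = flat []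
hooks-frob f       (0 ∷ xs)     _          (_ ∷ dec) = hooks-flat (refl ∷ decreasing-zeros dec)
hooks-frob (suc f) (suc x ∷ xs) (ℕ.s≤s le) (_ ∷ dec) = subst₂ (Hooks (suc x ∷ xs))
  (sym (frobX-hook x xs)) (sym (frobY-hook x xs dec))
  (hook refl (hooks-frob f (map ℕ.pred xs) (length-pred xs le) (decreasing-pred dec)))

sum-pred : ∀ xs → sum xs ≡ sum (map ℕ.pred xs) ℕ.+ conj xs 1
sum-pred []           = refl
sum-pred (0 ∷ xs)     = sum-pred xs
sum-pred (suc x ∷ xs) = trans (cong (λ s → suc x ℕ.+ s) (sum-pred xs)) (e₁ x (sum (map ℕ.pred xs)) (conj xs 1))
  where
  e₁ : ∀ x s c → suc x ℕ.+ (s ℕ.+ c) ≡ x ℕ.+ s ℕ.+ suc c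
  e₁ = ℕ-Ring.solve-∀

conj₁-pred : ∀ xs → conj (map ℕ.pred xs) 1 ℕ.≤ conj xs 1
conj₁-pred []                 = ℕ.z≤n
conj₁-pred (0 ∷ xs)           = conj₁-pred xs
conj₁-pred (1 ∷ xs)           = ℕₚ.m≤n⇒m≤1+n (conj₁-pred xs)
conj₁-pred (suc (suc x) ∷ xs) = ℕ.s≤s (conj₁-pred xs)

data Below : ℕ → List ℕ → Set where
  []  : ∀ {k} → Below k []
  _∷_ : ∀ {k x xs} → x ℕ.< k → Below x xs → Below k (x ∷ xs)

below-mono : ∀ {k l xs} → k ℕ.≤ l → Below k xs → Below l xs
below-mono k≤l []         = []
below-mono k≤l (x<k ∷ bs) = ℕₚ.<-≤-trans x<k k≤l ∷ bs

hooks-X-below : ∀ {k xs X Y} → Hooks xs X Y → Decreasing k xs → Below k X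
hooks-X-below (flat _)   _           = []
hooks-X-below (hook _ hk) (x<k ∷ dec) = x<k ∷ hooks-X-below hk (decreasing-pred dec)

hooks-Y-below : ∀ {xs X Y} → Hooks xs X Y → Below (conj xs 1) Y
hooks-Y-below (flat _)                = []
hooks-Y-below (hook {xs = xs} refl hk) = ℕₚ.≤-refl ∷ below-mono (conj₁-pred xs) (hooks-Y-below hk)

hooks-length : ∀ {xs X Y} → Hooks xs X Y → length X ≡ length Y
hooks-length (flat _)    = refl
hooks-length (hook _ hk) = cong suc (hooks-length hk)

sum-zeros : ∀ {xs} → All (_≡ 0) xs → sum xs ≡ 0
sum-zeros []          = refl
sum-zeros (refl ∷ zs) = sum-zeros zs

hooks-sum : ∀ {xs X Y} → Hooks xs X Y → sum xs ≡ sum X ℕ.+ sum Y ℕ.+ length Y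
hooks-sum (flat zs) = sum-zeros zs
hooks-sum (hook {x} {xs} {_} {X} {Y} refl hk) = begin
  suc x ℕ.+ sum xs
    ≡⟨ cong (λ s → suc x ℕ.+ s) (trans (sum-pred xs) (cong (ℕ._+ conj xs 1) (hooks-sum hk))) ⟩
  suc x ℕ.+ (sum X ℕ.+ sum Y ℕ.+ length Y ℕ.+ conj xs 1)
    ≡⟨ e₁ x (sum X) (sum Y) (length Y) (conj xs 1) ⟩
  x ℕ.+ sum X ℕ.+ (conj xs 1 ℕ.+ sum Y) ℕ.+ suc (length Y) ∎
  where
  open ≡-Reasoning
  e₁ : ∀ x a b l c → suc x ℕ.+ (a ℕ.+ b ℕ.+ l ℕ.+ c) ≡ x ℕ.+ a ℕ.+ (c ℕ.+ b) ℕ.+ suc l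
  e₁ = ℕ-Ring.solve-∀

decreasing-conj₁-zeros : ∀ {xs} → Decreasing 0 xs → conj xs 1 ≡ 0
decreasing-conj₁-zeros []            = refl
decreasing-conj₁-zeros (ℕ.z≤n ∷ dec) = decreasing-conj₁-zeros dec

-- `ℕ.pred` confuses only 0 and 1. In a decreasing list the zeros come last, so the number of
-- nonzero entries tells the two apart.
pred-injective : ∀ {k l xs ys} → Decreasing k xs → Decreasing l ys →
  map ℕ.pred xs ≡ map ℕ.pred ys → conj xs 1 ≡ conj ys 1 → xs ≡ ys
pred-injective []                        []                        eq c = refl
pred-injective (_∷_ {x = 0} _ dx)        (_∷_ {x = 0} _ dy)        eq c =
  cong (0 ∷_) (pred-injective dx dy (Listₚ.∷-injectiveʳ eq) c)
pred-injective (_∷_ {x = 0} _ dx)        (_∷_ {x = suc _} _ _)     eq c =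
  contradiction (trans (sym (decreasing-conj₁-zeros dx)) c) λ ()
pred-injective (_∷_ {x = suc _} _ _)     (_∷_ {x = 0} _ dy)        eq c =
  contradiction (trans c (decreasing-conj₁-zeros dy)) λ ()
pred-injective (_∷_ {x = suc x} _ dx)    (_∷_ {x = suc y} _ dy)    eq c =
  cong₂ (λ z zs → suc z ∷ zs) (Listₚ.∷-injectiveˡ eq) (pred-injective dx dy (Listₚ.∷-injectiveʳ eq) (ℕₚ.suc-injective c))

zeros-injective : ∀ {xs ys} → All (_≡ 0) xs → All (_≡ 0) ys → length xs ≡ length ys → xs ≡ ys
zeros-injective []          []          _ = refl
zeros-injective (refl ∷ zs) (refl ∷ ws) l = cong (0 ∷_) (zeros-injective zs ws (ℕₚ.suc-injective l))

-- Zero parts leave no trace in X and Y, hence the hypothesis of equal lengths. Each hook is put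
-- back by `pred-injective`, its leg being the number of nonzero entries below.
hooks-injective : ∀ {k l xs ys X Y} → Hooks xs X Y → Hooks ys X Y → length xs ≡ length ys →
  Decreasing k xs → Decreasing l ys → xs ≡ ys
hooks-injective (flat zs) (flat ws) len _ _ = zeros-injective zs ws len
hooks-injective (hook {x} {xs} refl hx) (hook {xs = ys} c hy) len (_ ∷ dx) (_ ∷ dy) =
  cong (suc x ∷_) (pred-injective dx dy (hooks-injective hx hy same (decreasing-pred dx) (decreasing-pred dy)) c)
  where
  same : length (map ℕ.pred xs) ≡ length (map ℕ.pred ys)
  same = trans (Listₚ.length-map ℕ.pred xs) (trans (ℕₚ.suc-injective len) (sym (Listₚ.length-map ℕ.pred ys)))

positive-length : ∀ {xs} → All (1 ℕ.≤_) xs → conj xs 1 ≡ length xs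
positive-length []               = refl
positive-length (ℕ.s≤s _ ∷ pos) = cong suc (positive-length pos)

-- The number of parts is one more than the first leg.
hooks-length-injective : ∀ {xs ys X Y} → Hooks xs X Y → Hooks ys X Y →
  All (1 ℕ.≤_) xs → All (1 ℕ.≤_) ys → length xs ≡ length ys
hooks-length-injective (flat [])        (flat [])        _         _         = refl
hooks-length-injective (flat (refl ∷ _)) _               (() ∷ _)  _
hooks-length-injective (flat [])        (flat (refl ∷ _)) _        (() ∷ _)
hooks-length-injective (hook refl _)    (hook c _)       (_ ∷ px)  (_ ∷ py)  =
  cong suc (trans (sym (positive-length px)) (trans c (positive-length py)))

-- Partitions correspond to symbols of charge 0

Ev-∈ : ∀ h {X Y} c w → Below h X → Below h Y → + length X - + length Y ≡ c → + sum X + + sum Y + + length Y ≡ w →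
  (X , Y) ∈ Ev h c w
Od-∈ : ∀ h {X Y} c w → Below (suc h) X → Below h Y → + length X - + length Y ≡ c → + sum X + + sum Y + + length Y ≡ w →
  (X , Y) ∈ Od h c w
Ev-∈ 0 _ _ [] [] refl refl = here refl
Ev-∈ (suc h) c w X [] ≡c ≡w = ∈-++⁺ˡ (Od-∈ h c w X [] ≡c ≡w)
Ev-∈ (suc h) {X} {y ∷ Y} c w bX (y<1+h ∷ bY) ≡c ≡w with y ℕ.≟ h
... | yes refl = ∈-++⁺ʳ (Od h c w) (∈-map⁺ (map₂ (h ∷_)) (Od-∈ h (c + 1ℤ) (w - + suc h) bX bY
  (trans (e₁ (+ length X) (+ length Y)) (cong (_+ 1ℤ) ≡c))
  (trans (e₂ (+ sum X) (+ h) (+ sum Y) (+ length Y)) (cong (_- + suc h) ≡w))))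
  where
  e₁ : ∀ x y → x - y ≡ x - (1ℤ + y) + 1ℤ
  e₁ = ℤ-Ring.solve-∀
  e₂ : ∀ x h y l → x + y + l ≡ x + (h + y) + (1ℤ + l) - (1ℤ + h)
  e₂ = ℤ-Ring.solve-∀
... | no y≢h = ∈-++⁺ˡ (Od-∈ h c w bX (ℕₚ.≤∧≢⇒< (ℕₚ.≤-pred y<1+h) y≢h ∷ bY) ≡c ≡w)
Od-∈ h c w [] bY ≡c ≡w = ∈-++⁺ˡ (Ev-∈ h c w [] bY ≡c ≡w)
Od-∈ h {x ∷ X} {Y} c w (x<1+h ∷ bX) bY ≡c ≡w with x ℕ.≟ h
... | yes refl = ∈-++⁺ʳ (Ev h c w) (∈-map⁺ (map₁ (h ∷_)) (Ev-∈ h (c - 1ℤ) (w - + h) bX bY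
  (trans (e₁ (+ length X) (+ length Y)) (cong (_- 1ℤ) ≡c))
  (trans (e₂ (+ sum X) (+ h) (+ sum Y) (+ length Y)) (cong (_- + h) ≡w))))
  where
  e₁ : ∀ x y → x - y ≡ 1ℤ + x - y - 1ℤ
  e₁ = ℤ-Ring.solve-∀
  e₂ : ∀ x h y l → x + y + l ≡ h + x + y + l - h
  e₂ = ℤ-Ring.solve-∀
... | no x≢h = ∈-++⁺ˡ (Ev-∈ h c w (ℕₚ.≤∧≢⇒< (ℕₚ.≤-pred x<1+h) x≢h ∷ bX) bY ≡c ≡w)

unique-⊆-↭ : {A : Set} {xs ys : List A} → Unique xs → All (_∈ ys) xs → length xs ≡ length ys → xs ↭ ys
unique-⊆-↭ {ys = []} [] [] _ = ↭-refl
unique-⊆-↭ {xs = x ∷ xs} (x∉xs ∷ uniq) (x∈ys ∷ xs⊆ys) len with ∈-∃++ x∈ys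
... | us , vs , refl = ↭-trans (prep x (unique-⊆-↭ uniq (remove x∉xs xs⊆ys) (ℕₚ.suc-injective
    (trans len (↭ₚ.↭-length (↭ₚ.shift x us vs)))))) (↭-sym (↭ₚ.shift x us vs))
  where
  remove : ∀ {zs} → All (x ≢_) zs → All (_∈ us ++ x ∷ vs) zs → All (_∈ us ++ vs) zs
  remove []          []          = []
  remove (x≢z ∷ x∉) (z∈ ∷ zs⊆) with ∈-++⁻ us z∈
  ... | inj₁ z∈us         = ∈-++⁺ˡ z∈us ∷ remove x∉ zs⊆
  ... | inj₂ (here z≡x)   = contradiction (sym z≡x) x≢z
  ... | inj₂ (there z∈vs) = ∈-++⁺ʳ us z∈vs ∷ remove x∉ zs⊆

unique-map : {A B : Set} {P : A → Set} (f : A → B) → (∀ {x y} → P x → P y → f x ≡ f y → x ≡ y) →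
  ∀ {xs} → All P xs → Unique xs → Unique (map f xs)
unique-map f inj []         []          = []
unique-map {P = P} f inj (px ∷ pxs) (x∉ ∷ uniq) = Allₚ.map⁺ (fresh pxs x∉) ∷ unique-map f inj pxs uniq
  where
  fresh : ∀ {zs} → All P zs → All (_ ≢_) zs → All (λ z → f _ ≢ f z) zs
  fresh []         []          = []
  fresh (pz ∷ pzs) (x≢z ∷ x≢s) = (x≢z ∘ inj px pz) ∷ fresh pzs x≢s

count-↭ : {A : Set} (Q : A → Bool) {xs ys : List A} → xs ↭ ys → count Q xs ≡ count Q ys
count-↭ Q _↭_.refl                = refl
count-↭ Q (prep x p)              = cong (χ (Q x) ℕ.+_) (count-↭ Q p)
count-↭ Q (swap {xs} {ys} x y p)  = trans (e₁ (χ (Q x)) (χ (Q y)) (count Q xs)) (cong (λ c → χ (Q y) ℕ.+ (χ (Q x) ℕ.+ c)) (count-↭ Q p))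
  where
  e₁ : ∀ a b c → a ℕ.+ (b ℕ.+ c) ≡ b ℕ.+ (a ℕ.+ c)
  e₁ = ℕ-Ring.solve-∀
count-↭ Q (_↭_.trans p q)         = trans (count-↭ Q p) (count-↭ Q q)

frob : List ℕ → Strip
frob xs = frobX xs , frobY xs

partition-hooks : ∀ {k n xs} → IsPartition k n xs → Hooks xs (frobX xs) (frobY xs)
partition-hooks (isPartition dec _ _) = hooks-frob _ _ ℕₚ.≤-refl dec

frob-injective : ∀ {k l n m xs ys} → IsPartition k n xs → IsPartition l m ys → frob xs ≡ frob ys → xs ≡ ys
frob-injective {xs = xs} {ys} px@(isPartition dx +x _) py@(isPartition dy +y _) eq =
  hooks-injective hx hy (hooks-length-injective hx hy +x +y) dx dy
  where
  hx = partition-hooks px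
  hy = subst₂ (Hooks ys) (sym (cong proj₁ eq)) (sym (cong proj₂ eq)) (partition-hooks py)

frob-∈ : ∀ {L n xs} → n ℕ.≤ L → IsPartition n n xs → frob xs ∈ Ev L 0ℤ (+ n)
frob-∈ {L} {n} {xs} n≤L px@(isPartition dec _ ≡n) = Ev-∈ L 0ℤ (+ n)
  (below-mono n≤L (hooks-X-below hk dec))
  (below-mono (ℕₚ.≤-trans conj≤n n≤L) (hooks-Y-below hk))
  (trans (cong (λ l → + l - + length (frobY xs)) (hooks-length hk)) (ℤₚ.+-inverseʳ (+ length (frobY xs))))
  (cong +_ (trans (sym (hooks-sum hk)) ≡n))
  where
  hk = partition-hooks px
  conj≤n : conj xs 1 ℕ.≤ n
  conj≤n = subst (conj xs 1 ℕ.≤_) (trans (sym (sum-pred xs)) ≡n) (ℕₚ.m≤n+m (conj xs 1) _)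

length-Ev₀ : ∀ {L n} → n ℕ.≤ L → length (Ev L 0ℤ (+ n)) ≡ p n
length-Ev₀ {L} {n} n≤L = begin
  length (Ev L 0ℤ (+ n))               ≡⟨ length-Ev L 0ℤ (+ n) ⟩
  g (dbl L) (+ L + 0ℤ) (+ n - 0ℤ)      ≡⟨ cong₂ (g (dbl L)) (ℤₚ.+-identityʳ (+ L)) (ℤₚ.+-identityʳ (+ n)) ⟩
  g (dbl L) (+ L) (+ n)                ≡⟨ cong (λ t → g t (+ L) (+ n)) (ℤₚ.+-injective (dbl-+ L)) ⟩
  g (L ℕ.+ L) (+ L) (+ n)              ≡⟨ ℤₚ.+-injective (g-pℤ L L (+ n) λ { _ refl → n≤L , n≤L }) ⟩
  p n                                  ∎
  where open ≡-Reasoning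

-- `frob` maps injectively into the right-hand list, and both lists have `p n` elements by
-- `length-Ev₀`; the pigeonhole principle `unique-⊆-↭` gives the rest.
partitions-↭ : ∀ {L n} → n ℕ.≤ L → map frob (partitions n) ↭ Ev L 0ℤ (+ n)
partitions-↭ {L} {n} n≤L = unique-⊆-↭
  (unique-map frob frob-injective all (partsLE-unique n n n))
  (Allₚ.map⁺ (All.map (frob-∈ n≤L) all))
  (trans (Listₚ.length-map frob (partitions n)) (sym (length-Ev₀ n≤L)))
  where all = partsLE-isPartition n n n

mutual
  -- The underscore is solved to the function local to colSigns.
  zipSigns≡signs : ∀ xs X Y → _ ≡ signs X Y
  colSigns≡signs : ∀ xs → colSigns xs ≡ signs (frobX xs) (frobY xs)
  colSigns≡signs xs with frobX xs | frobY xs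
  ... | X | Y = zipSigns≡signs xs X Y
  zipSigns≡signs xs []      Y       = refl
  zipSigns≡signs xs (x ∷ X) []      = refl
  zipSigns≡signs xs (x ∷ X) (y ∷ Y) = cong (⌊ y ℕ.<? x ⌋ ∷_) (zipSigns≡signs xs X Y)

-- `L` is left free because the reflected side may ask for a bound larger than n.
count-partitions : ∀ (Q : List Bool → Bool) {L n} → n ℕ.≤ L →
  count (Q ∘ colSigns) (partitions n) ≡ count (λ (X , Y) → Q (signs X Y)) (Ev L 0ℤ (+ n))
count-partitions Q {L} {n} n≤L = begin
  count (Q ∘ colSigns) (partitions n)                       ≡⟨ count-ext (λ xs → cong Q (colSigns≡signs xs)) (partitions n) ⟩
  count (Q′ ∘ frob) (partitions n)                          ≡⟨ count-map Q′ frob (partitions n) ⟨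
  count Q′ (map frob (partitions n))                        ≡⟨ count-↭ Q′ (partitions-↭ n≤L) ⟩
  count Q′ (Ev L 0ℤ (+ n))                                  ∎
  where
  open ≡-Reasoning
  Q′ : Strip → Bool
  Q′ (X , Y) = Q (signs X Y)

-- Pentagonal numbers

-- The weight shift p(n) ↦ p(n − q f m), a pentagonal number.
q : Bool → ℕ → ℕ
q f     0       = 0
q true  (suc m) = q false m ℕ.+ (2 ℕ.+ (d false m ℕ.+ d false m))
q false (suc m) = q true m ℕ.+ (1 ℕ.+ (d true m ℕ.+ d true m))

-- By `length-Ev`, charge δ and weight n + e leave n - (T δ - e) for the Gaussian binomial, so this
-- difference is the total shift made by the m reflections.
T-δ : ∀ f m → T (δ f m) - e f m ≡ + q f m
T-δ true  0 = refl
T-δ false 0 = refl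
T-δ true (suc m) = begin
  1ℤ + k + (k + t) - (e false m - 1ℤ + - k)    ≡⟨ e₁ k t (e false m) ⟩
  t + k - e false m + (1ℤ + 1ℤ + (k + k))      ≡⟨ cong (λ u → u - e false m + (1ℤ + 1ℤ + (k + k))) (T-neg k) ⟨
  T (- k) - e false m + (1ℤ + 1ℤ + (k + k))    ≡⟨ cong (_+ (1ℤ + 1ℤ + (k + k))) (T-δ false m) ⟩
  + q true (suc m)                             ∎
  where
  open ≡-Reasoning
  k = + d false m
  t = T k
  e₁ : ∀ k t e → 1ℤ + k + (k + t) - (e - 1ℤ + - k) ≡ t + k - e + (1ℤ + 1ℤ + (k + k))
  e₁ = ℤ-Ring.solve-∀
T-δ false (suc m) = begin
  1ℤ + k + (k + t) - e true m            ≡⟨ e₁ k t (e true m) ⟩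
  t - e true m + (1ℤ + (k + k))          ≡⟨ cong (_+ (1ℤ + (k + k))) (T-δ true m) ⟩
  + q false (suc m)                      ∎
  where
  open ≡-Reasoning
  k = + d true m
  t = T k
  e₁ : ∀ k t e → 1ℤ + k + (k + t) - e ≡ t - e + (1ℤ + (k + k))
  e₁ = ℤ-Ring.solve-∀

-- With L = n + d the sides L + δ and L - δ of the box are n and n + 2d in some order. Both are at
-- least n, so the box imposes no restriction.
length-Ev-δ : ∀ f m n → + length (Ev (n ℕ.+ d f m) (0ℤ + δ f m) (+ n + e f m)) ≡ pℤ (+ n - + q f m)
length-Ev-δ f m n = begin
  + length (Ev L (0ℤ + δ f m) (+ n + e f m))
    ≡⟨ cong (λ c → + length (Ev L c (+ n + e f m))) (ℤₚ.+-identityˡ (δ f m)) ⟩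
  + length (Ev L (δ f m) (+ n + e f m))
    ≡⟨ cong +_ (length-Ev L (δ f m) _) ⟩
  + g (dbl L) (+ L + δ f m) (+ n + e f m - T (δ f m))
    ≡⟨ cong (λ w → + g (dbl L) (+ L + δ f m) w) (trans (e₁ (+ n) (e f m) (T (δ f m))) (cong (λ u → + n - u) (T-δ f m))) ⟩
  + g (dbl L) (+ L + δ f m) v
    ≡⟨ box f ⟩
  pℤ v ∎
  where
  open ≡-Reasoning
  L = n ℕ.+ d f m
  v = + n - + q f m
  e₁ : ∀ n e t → n + e - t ≡ n - (t - e)
  e₁ = ℤ-Ring.solve-∀
  dbl-L : ∀ n k → dbl (n ℕ.+ k) ≡ n ℕ.+ (n ℕ.+ k ℕ.+ k)
  dbl-L n k = trans (ℤₚ.+-injective (dbl-+ (n ℕ.+ k))) (e₂ n k)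
    where
    e₂ : ∀ n k → n ℕ.+ k ℕ.+ (n ℕ.+ k) ≡ n ℕ.+ (n ℕ.+ k ℕ.+ k)
    e₂ = ℕ-Ring.solve-∀
  v≤n : ∀ k → v ≡ + k → k ℕ.≤ n
  v≤n k eq = ℤₚ.drop‿+≤+ (subst (Data.Integer._≤ + n) (trans (sym (ℤₚ.m-n≡m⊖n n (q f m))) eq) (ℤₚ.m⊖n≤m n (q f m)))
  grow : ∀ {k} x → k ℕ.≤ n → k ℕ.≤ n ℕ.+ x ℕ.+ x
  grow x k≤n = ℕₚ.≤-trans k≤n (ℕₚ.≤-trans (ℕₚ.m≤m+n n x) (ℕₚ.m≤m+n (n ℕ.+ x) x))
  cancel : ∀ n k → n + k + - k ≡ n
  cancel = ℤ-Ring.solve-∀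
  box : ∀ f → + g (dbl (n ℕ.+ d f m)) (+ (n ℕ.+ d f m) + δ f m) v ≡ pℤ v
  box true  = trans (cong (λ t → + g t (+ (n ℕ.+ k ℕ.+ k)) v) (trans (dbl-L n k) (ℕₚ.+-comm n (n ℕ.+ k ℕ.+ k))))
    (g-pℤ (n ℕ.+ k ℕ.+ k) n v λ j eq → grow k (v≤n j eq) , v≤n j eq)
    where k = d true m
  box false = trans (cong₂ (λ t i → + g t i v) (dbl-L n k) (cancel (+ n) (+ k)))
    (g-pℤ n (n ℕ.+ k ℕ.+ k) v λ j eq → v≤n j eq , grow k (v≤n j eq))
    where k = d false m

count-alt-q : ∀ f m n → + count (alt f m ∘ colSigns) (partitions n) ≡ pℤ (+ n - + q f m)
count-alt-q f m n = trans (cong +_ (trans (count-partitions (alt f m) (ℕₚ.m≤m+n n (d f m))) (reflect f))) (length-Ev-δ f m n)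
  where
  reflect : ∀ f → count (altSigns f m [] []) (Ev (n ℕ.+ d f m) 0ℤ (+ n)) ≡ length (Ev (n ℕ.+ d f m) (0ℤ + δ f m) (+ n + e f m))
  reflect true  = Ev-pos (n ℕ.+ d true m) m [] (+ n) []
  reflect false = Ev-neg (n ℕ.+ d false m) m [] (+ n) []

-- The last entry of the alternating sequence f, not f, … of length m.
last : Bool → ℕ → Bool
last f 0       = not f
last f (suc m) = last (not f) m

sg : Bool → ℤ
sg true  = 1ℤ
sg false = - 1ℤ

-- `d` grows by 2 and 1 in turn, so it is 3m/2 up to a correction of at most 1/2 set by the first
-- and last signs. The factor 4 clears the denominators.
d-closed : ∀ f m → + 4 * + d f m ≡ + 6 * + m + sg f + sg (last f m)
d-closed true  0 = refl
d-closed false 0 = refl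
d-closed true (suc m) = trans (e₁ (+ d false m)) (trans (cong (_+ + 8) (d-closed false m)) (e₂ (+ m) (sg (last false m))))
  where
  e₁ : ∀ d → + 4 * (1ℤ + (1ℤ + d)) ≡ + 4 * d + + 8
  e₁ = ℤ-Ring.solve-∀
  e₂ : ∀ m ε → + 6 * m + - 1ℤ + ε + + 8 ≡ + 6 * (1ℤ + m) + 1ℤ + ε
  e₂ = ℤ-Ring.solve-∀
d-closed false (suc m) = trans (e₁ (+ d true m)) (trans (cong (_+ + 4) (d-closed true m)) (e₂ (+ m) (sg (last true m))))
  where
  e₁ : ∀ d → + 4 * (1ℤ + d) ≡ + 4 * d + + 4
  e₁ = ℤ-Ring.solve-∀
  e₂ : ∀ m ε → + 6 * m + 1ℤ + ε + + 4 ≡ + 6 * (1ℤ + m) + - 1ℤ + ε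
  e₂ = ℤ-Ring.solve-∀

-- The first sign, present in `d-closed`, is compensated by the constants 2 and 1 in `q`; the last
-- sign alone selects the kind of pentagonal number.
q-closed : ∀ f m → + q f m * + 2 ≡ + 3 * + m * + m + sg (last f m) * + m
q-closed true  0 = refl
q-closed false 0 = refl
q-closed true (suc m) = begin
  (+ q false m + (1ℤ + 1ℤ + (+ k + + k))) * + 2         ≡⟨ e₁ (+ q false m) (+ k) ⟩
  + q false m * + 2 + + 4 * + k + + 4                   ≡⟨ cong₂ (λ u v → u + v + + 4) (q-closed false m) (d-closed false m) ⟩
  + 3 * + m * + m + ε * + m + (+ 6 * + m + - 1ℤ + ε) + + 4 ≡⟨ e₂ (+ m) ε ⟩
  + 3 * (1ℤ + + m) * (1ℤ + + m) + ε * (1ℤ + + m)        ∎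
  where
  open ≡-Reasoning
  k = d false m
  ε = sg (last false m)
  e₁ : ∀ q k → (q + (1ℤ + 1ℤ + (k + k))) * + 2 ≡ q * + 2 + + 4 * k + + 4
  e₁ = ℤ-Ring.solve-∀
  e₂ : ∀ m ε → + 3 * m * m + ε * m + (+ 6 * m + - 1ℤ + ε) + + 4 ≡ + 3 * (1ℤ + m) * (1ℤ + m) + ε * (1ℤ + m)
  e₂ = ℤ-Ring.solve-∀
q-closed false (suc m) = begin
  (+ q true m + (1ℤ + (+ k + + k))) * + 2               ≡⟨ e₁ (+ q true m) (+ k) ⟩
  + q true m * + 2 + + 4 * + k + + 2                    ≡⟨ cong₂ (λ u v → u + v + + 2) (q-closed true m) (d-closed true m) ⟩
  + 3 * + m * + m + ε * + m + (+ 6 * + m + 1ℤ + ε) + + 2 ≡⟨ e₂ (+ m) ε ⟩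
  + 3 * (1ℤ + + m) * (1ℤ + + m) + ε * (1ℤ + + m)        ∎
  where
  open ≡-Reasoning
  k = d true m
  ε = sg (last true m)
  e₁ : ∀ q k → (q + (1ℤ + (k + k))) * + 2 ≡ q * + 2 + + 4 * k + + 2
  e₁ = ℤ-Ring.solve-∀
  e₂ : ∀ m ε → + 3 * m * m + ε * m + (+ 6 * m + 1ℤ + ε) + + 2 ≡ + 3 * (1ℤ + m) * (1ℤ + m) + ε * (1ℤ + m)
  e₂ = ℤ-Ring.solve-∀

pen : Bool → ℕ → ℕ
pen true  = penPlus
pen false = penMinus

q-pen : ∀ f m → q f m ≡ pen (last f m) m
q-pen f m with last f m | q-closed f m
... | true  | closed = sym (trans (cong (_/ 2) (ℤₚ.+-injective (begin
    + (3 ℕ.* m ℕ.* m) + + m           ≡⟨ cong₂ _+_ square (sym (ℤₚ.*-identityˡ (+ m))) ⟩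
    + 3 * + m * + m + 1ℤ * + m        ≡⟨ closed ⟨
    + q f m * + 2                     ≡⟨ ℤₚ.pos-* (q f m) 2 ⟨
    + (q f m ℕ.* 2)                   ∎))) (m*n/n≡m (q f m) 2))
  where
  open ≡-Reasoning
  square : + (3 ℕ.* m ℕ.* m) ≡ + 3 * + m * + m
  square = trans (ℤₚ.pos-* (3 ℕ.* m) m) (cong (_* + m) (ℤₚ.pos-* 3 m))
... | false | closed = sym (trans (cong (λ k → (k ℕ.∸ m) / 2) (ℤₚ.+-injective (begin
    + (3 ℕ.* m ℕ.* m)                       ≡⟨ square ⟩
    + 3 * + m * + m                         ≡⟨ e₁ (+ 3 * + m * + m) (+ m) ⟩
    + 3 * + m * + m + - 1ℤ * + m + + m      ≡⟨ cong (_+ + m) closed ⟨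
    + q f m * + 2 + + m                     ≡⟨ cong (_+ + m) (ℤₚ.pos-* (q f m) 2) ⟨
    + (q f m ℕ.* 2 ℕ.+ m)                   ∎)))
  (trans (cong (_/ 2) (ℕₚ.m+n∸n≡m (q f m ℕ.* 2) m)) (m*n/n≡m (q f m) 2)))
  where
  open ≡-Reasoning
  square : + (3 ℕ.* m ℕ.* m) ≡ + 3 * + m * + m
  square = trans (ℤₚ.pos-* (3 ℕ.* m) m) (cong (_* + m) (ℤₚ.pos-* 3 m))
  e₁ : ∀ s m → s ≡ s + - 1ℤ * m + m
  e₁ = ℤ-Ring.solve-∀

count-alt : ∀ f m n → + count (alt f m ∘ colSigns) (partitions n) ≡ pℤ (+ n - + pen (last f m) m)
count-alt f m n = trans (count-alt-q f m n) (cong (λ k → pℤ (+ n - + k)) (q-pen f m))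

-- Parity blocks

blocks : ℕ → Bool → List Bool → Bool
blocks m s []       = false
blocks m s (b ∷ bs) = ⌊ runs (b ∷ bs) ℕ.≟ m ⌋ ∧ (lastSign bs b == s)

hasBlocks≡blocks : ∀ m s xs → hasBlocks m s xs ≡ blocks m s (colSigns xs)
hasBlocks≡blocks m s xs with colSigns xs
... | []     = refl
... | b ∷ bs = refl

≟-suc : ∀ r m → ⌊ suc r ℕ.≟ suc m ⌋ ≡ ⌊ r ℕ.≟ m ⌋
≟-suc r m = trans (isYes≗does (suc r ℕ.≟ suc m)) (sym (isYes≗does (r ℕ.≟ m)))

runs≢0 : ∀ b bs → ⌊ runs (b ∷ bs) ℕ.≟ 0 ⌋ ≡ false
runs≢0 b     []           = refl
runs≢0 true  (true ∷ bs)  = runs≢0 true bs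
runs≢0 true  (false ∷ bs) = refl
runs≢0 false (true ∷ bs)  = refl
runs≢0 false (false ∷ bs) = runs≢0 false bs

runs-change : ∀ b bs → runs (b ∷ not b ∷ bs) ≡ suc (runs (not b ∷ bs))
runs-change true  bs = refl
runs-change false bs = refl

blocks-change : ∀ m s b bs → blocks (suc m) s (b ∷ not b ∷ bs) ≡ blocks m s (not b ∷ bs)
blocks-change m s b bs = cong (_∧ (lastSign bs (not b) == s))
  (trans (cong (λ r → ⌊ r ℕ.≟ suc m ⌋) (runs-change b bs)) (≟-suc (runs (not b ∷ bs)) m))

blocks-0 : ∀ s bs → blocks 0 s bs ≡ false
blocks-0 s []       = refl
blocks-0 s (b ∷ bs) = cong (_∧ (lastSign bs b == s)) (runs≢0 b bs)

blocks-1-change : ∀ s b bs → blocks 1 s (b ∷ not b ∷ bs) ≡ false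
blocks-1-change s b bs = trans (blocks-change 0 s b bs) (blocks-0 s (not b ∷ bs))

alt-repeat : ∀ f m b bs → alt f m (b ∷ b ∷ bs) ≡ alt f m (b ∷ bs)
alt-repeat f     0             b     bs = refl
alt-repeat true  1             true  bs = refl
alt-repeat true  (suc (suc m)) true  bs = refl
alt-repeat true  (suc m)       false bs = refl
alt-repeat false (suc m)       true  bs = refl
alt-repeat false 1             false bs = refl
alt-repeat false (suc (suc m)) false bs = refl

-- Of two opposite entries exactly one is f. If it is b, the test consumes b; if it is `not b`, then
-- b is skipped and `alt-hit` keeps `not b` in the list.
alt-change : ∀ f m b bs → alt f (suc m) (b ∷ not b ∷ bs) ≡ alt (not f) m (not b ∷ bs)
alt-change true  m true  bs = refl
alt-change true  m false bs = alt-hit true m bs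
alt-change false m true  bs = alt-hit false m bs
alt-change false m false bs = refl

-- Consecutive conditions alt f m differ by the sign sequences with m or m + 1
-- blocks that end in the last sign of the pattern.
BlocksAlt : Bool → ℕ → List Bool → Set
BlocksAlt f m bs =
  χ (blocks m (last f m) bs) ℕ.+ χ (blocks (suc m) (last f m) bs) ℕ.+ χ (alt f (suc m) bs) ≡ χ (alt f m bs)

-- Induction on the list: a repeated sign affects no term, and a change of sign lowers m and turns f
-- into `not f` in every term, with the same last sign.
blocks-alt : ∀ f m b bs → BlocksAlt f m (b ∷ bs)
blocks-alt-change : ∀ f m b bs → BlocksAlt f m (b ∷ not b ∷ bs)

blocks-alt true  0             true  [] = refl
blocks-alt true  0             false [] = refl
blocks-alt false 0             true  [] = refl
blocks-alt false 0             false [] = refl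
blocks-alt true  1             true  [] = refl
blocks-alt true  1             false [] = refl
blocks-alt false 1             true  [] = refl
blocks-alt false 1             false [] = refl
blocks-alt true  (suc (suc m)) true  [] = refl
blocks-alt true  (suc (suc m)) false [] = refl
blocks-alt false (suc (suc m)) true  [] = refl
blocks-alt false (suc (suc m)) false [] = refl
blocks-alt f m true  (true ∷ bs)  rewrite alt-repeat f m true bs | alt-repeat f (suc m) true bs = blocks-alt f m true bs
blocks-alt f m true  (false ∷ bs) = blocks-alt-change f m true bs
blocks-alt f m false (true ∷ bs)  = blocks-alt-change f m false bs
blocks-alt f m false (false ∷ bs) rewrite alt-repeat f m false bs | alt-repeat f (suc m) false bs = blocks-alt f m false bs

-- Both signs occur, so there are at least two blocks and `alt f 1` holds: the identity reads 0 + 0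
-- + 1 = 1.
blocks-alt-change f 0 b bs
  rewrite blocks-0 (not f) (b ∷ not b ∷ bs) | blocks-1-change (not f) b bs | alt-change f 0 b bs = refl
blocks-alt-change f (suc m) b bs
  rewrite blocks-change m (last (not f) m) b bs | blocks-change (suc m) (last (not f) m) b bs
        | alt-change f (suc m) b bs | alt-change f m b bs = blocks-alt (not f) m (not b) bs

partition-blocks-alt : ∀ f m {k n xs} → n ≥ 1 → IsPartition k n xs → BlocksAlt f m (colSigns xs)
partition-blocks-alt f m {xs = xs} n≥1 px = subst (BlocksAlt f m) (sym (colSigns≡signs xs))
  (nonempty (frobX xs) (frobY xs) (hooks-length hk) (trans (sym (hooks-sum hk)) (IsPartition.total px)))
  where
  hk = partition-hooks px
  nonempty : ∀ X Y → length X ≡ length Y → sum X ℕ.+ sum Y ℕ.+ length Y ≡ _ → BlocksAlt f m (signs X Y)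
  -- For m = 0 the empty list would violate the identity, which would read 0 = 1; n ≥ 1 rules it
  -- out.
  nonempty []      []      _ weight = contradiction (subst (_≥ 1) (sym weight) n≥1) λ ()
  nonempty (x ∷ X) (y ∷ Y) _ _      = blocks-alt f m _ (signs X Y)

-- Summation over partitions and the recursion in m

count-add : {A : Set} {Q R S U : A → Bool} {xs : List A} →
  All (λ x → χ (Q x) ℕ.+ χ (R x) ℕ.+ χ (S x) ≡ χ (U x)) xs → count Q xs ℕ.+ count R xs ℕ.+ count S xs ≡ count U xs
count-add [] = refl
count-add {Q = Q} {R} {S} {xs = x ∷ xs} (eq ∷ eqs) =
  trans (e₁ (χ (Q x)) (χ (R x)) (χ (S x)) (count Q xs) (count R xs) (count S xs)) (cong₂ ℕ._+_ eq (count-add eqs))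
  where
  e₁ : ∀ a b c x y z → (a ℕ.+ x) ℕ.+ (b ℕ.+ y) ℕ.+ (c ℕ.+ z) ≡ (a ℕ.+ b ℕ.+ c) ℕ.+ (x ℕ.+ y ℕ.+ z)
  e₁ = ℕ-Ring.solve-∀

-- a true and a false are the a⁺ and a⁻ of the paper.
a : Bool → ℕ → ℕ → ℕ
a s m n = count (blocks m s ∘ colSigns) (partitions n)

length-hasBlocks : ∀ s m n → length (filter (λ xs → hasBlocks m s xs Data.Bool.≟ true) (partitions n)) ≡ a s m n
length-hasBlocks s m n = trans (length-filter (partitions n)) (count-ext (hasBlocks≡blocks m s) (partitions n))
  where
  length-filter : ∀ xss → length (filter (λ xs → hasBlocks m s xs Data.Bool.≟ true) xss) ≡ count (hasBlocks m s) xss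
  length-filter []         = refl
  length-filter (xs ∷ xss) with hasBlocks m s xs
  ... | true  = cong suc (length-filter xss)
  ... | false = length-filter xss

a-0 : ∀ s n → a s 0 n ≡ 0
a-0 s n = trans (count-ext (λ xs → blocks-0 s (colSigns xs)) (partitions n)) (none (partitions n))
  where
  none : ∀ (xss : List (List ℕ)) → count (λ _ → false) xss ≡ 0
  none []         = refl
  none (_ ∷ xss) = none xss

-- The first entry of the alternating sequence of length m with last entry s.
first : Bool → ℕ → Bool
first s 0       = not s
first s (suc m) = not (first s m)

last-first : ∀ s m → last (first s m) m ≡ s
last-first s 0       = not-involutive s
last-first s (suc m) = trans (cong (λ f → last f m) (not-involutive (first s m))) (last-first s m)

last-not : ∀ f m → last (not f) m ≡ not (last f m)
last-not f 0       = refl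
last-not f (suc m) = last-not (not f) m

-- For s `true` or `false` this computes to the summand for a⁺ or a⁻, so `a-formula` gives the
-- theorem without rewriting.
D : ℕ → Bool → ℕ → ℤ
D n s l = pℤ (+ n - + pen s l) - pℤ (+ n - + pen (not s) (suc l))

-- `BlocksAlt` summed over all partitions of n. The pattern starting with `first s m` ends in s at
-- length m and in `not s` at length m + 1, hence the two kinds of pentagonal number in `D`.
a-suc : ∀ s m n → n ≥ 1 → + a s (suc m) n ≡ D n s m - + a s m n
a-suc s m n n≥1 = begin
  + a s (suc m) n
    ≡⟨ e₁ (+ a s m n) (+ a s (suc m) n) (+ A (suc m)) ⟩
  + a s m n + + a s (suc m) n + + A (suc m) - + A (suc m) - + a s m n
    ≡⟨ cong (λ u → u - + A (suc m) - + a s m n) (cong +_ (count-add pointwise)) ⟩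
  + A m - + A (suc m) - + a s m n
    ≡⟨ cong (_- + a s m n) (cong₂ _-_ (count-alt f m n) (count-alt f (suc m) n)) ⟩
  pℤ (+ n - + pen (last f m) m) - pℤ (+ n - + pen (last f (suc m)) (suc m)) - + a s m n
    ≡⟨ cong₂ (λ u v → pℤ (+ n - + pen u m) - pℤ (+ n - + pen v (suc m)) - + a s m n)
         (last-first s m) (trans (last-not f m) (cong not (last-first s m))) ⟩
  D n s m - + a s m n ∎
  where
  open ≡-Reasoning
  f = first s m
  A : ℕ → ℕ
  A m = count (alt f m ∘ colSigns) (partitions n)
  e₁ : ∀ x y z → y ≡ x + y + z - z - x
  e₁ = ℤ-Ring.solve-∀
  pointwise : All (λ xs → χ (blocks m s (colSigns xs)) ℕ.+ χ (blocks (suc m) s (colSigns xs)) ℕ.+ χ (alt f (suc m) (colSigns xs))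
    ≡ χ (alt f m (colSigns xs))) (partitions n)
  pointwise = All.map (λ {xs} px → subst (λ s → χ (blocks m s (colSigns xs)) ℕ.+ χ (blocks (suc m) s (colSigns xs))
      ℕ.+ χ (alt f (suc m) (colSigns xs)) ≡ χ (alt f m (colSigns xs))) (last-first s m) (partition-blocks-alt f m n≥1 px))
    (partsLE-isPartition n n n)

sgn-suc : ∀ m → sgn (suc m) ≡ - sgn m
sgn-suc 0             = refl
sgn-suc 1             = refl
sgn-suc (suc (suc m)) = sgn-suc m

sgn-square : ∀ m → sgn m * sgn m ≡ 1ℤ
sgn-square 0             = refl
sgn-square 1             = refl
sgn-square (suc (suc m)) = sgn-square m

a-formula : ∀ s m n → n ≥ 1 → + a s (suc m) n ≡ sgn m * sumTo (suc m) (λ l → sgn l * D n s l)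
a-formula s 0 n n≥1 = trans (a-suc s 0 n n≥1) (trans (cong (λ k → D n s 0 - + k) (a-0 s n)) (e₁ (D n s 0)))
  where
  e₁ : ∀ x → x - 0ℤ ≡ 1ℤ * (0ℤ + 1ℤ * x)
  e₁ = ℤ-Ring.solve-∀
a-formula s (suc m) n n≥1 = begin
  + a s (suc (suc m)) n                                   ≡⟨ a-suc s (suc m) n n≥1 ⟩
  x - + a s (suc m) n                                     ≡⟨ cong (λ u → x - u) (a-formula s m n n≥1) ⟩
  x - sgn m * S                                           ≡⟨ e₁ x (sgn m) S ⟩
  - sgn m * S + 1ℤ * x                                    ≡⟨ cong₂ (λ u v → u * S + v * x) (sgn-suc m) (sgn-square (suc m)) ⟨
  sgn (suc m) * S + sgn (suc m) * sgn (suc m) * x         ≡⟨ e₂ (sgn (suc m)) S x ⟩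
  sgn (suc m) * (S + sgn (suc m) * x)                     ∎
  where
  open ≡-Reasoning
  x = D n s (suc m)
  S = sumTo (suc m) (λ l → sgn l * D n s l)
  e₁ : ∀ x σ S → x - σ * S ≡ - σ * S + 1ℤ * x
  e₁ = ℤ-Ring.solve-∀
  e₂ : ∀ σ S x → σ * S + σ * σ * x ≡ σ * (S + σ * x)
  e₂ = ℤ-Ring.solve-∀

theorem5p2 : (m n : ℕ) → m ≥ 1 → n ≥ 1 →
    ((+ aPlus m n) ≡ sgn (m Data.Nat.∸ 1) * sumTo m (λ l → sgn l *
    (pℤ (+ n - + penPlus l) - pℤ (+ n - + penMinus (suc l)))))
    × ((+ aMinus m n) ≡ sgn (m Data.Nat.∸ 1) * sumTo m (λ l → sgn l *
    (pℤ (+ n - + penMinus l) - pℤ (+ n - + penPlus (suc l)))))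
theorem5p2 (suc m) n _ n≥1 =
  trans (cong +_ (length-hasBlocks true (suc m) n)) (a-formula true m n n≥1) ,
  trans (cong +_ (length-hasBlocks false (suc m) n)) (a-formula false m n n≥1)
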